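{- Let $G$ be a connected graph with at least two vertices, let $ST(G)=(T,\mathcal F)$ be its split-tree, and let its leaves and marker vertices be marked (assigned states) with respect to a non-empty subset $S$ of the leaves (that is, of $V(G)$). Then exactly one of the following conditions holds: 1. $ST(G)$ contains a clique node whose marker vertices are all perfect, and this node is unique; 2. $ST(G)$ contains a star node whose marker vertices are all empty except the centre, which is perfect, and this node is unique; 3. $ST(G)$ contains a unique hybrid node, and this node is prime; 4. $ST(G)$ contains a unique hybrid node, and this node is degenerate; 5. $ST(G)$ contains a $PP$ tree-edge, and this edge is unique; 6. $ST(G)$ contains a $PE$ tree-edge, and this edge is unique; 7. $ST(G)$ contains a unique fully-mixed subtree. Moreover, in every case, the unique node/edge/subtree is obtained from $T$ by deleting, for every tree-edge $e$ with a perfect or empty extremity $q$ whose opposite $r$ is mixed, the tree-edge $e$ and the node or leaf corresponding to $r$ (the node whose label contains $r$, or the leaf $r$ itself). In cases 1 and 2, what is obtained in this way is the node together with its adjacent tree-edges.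
   Context: Graphs are finite, simple and undirected. For a vertex set $S$, $N(S)=(\bigcup_{x\in S}N(x))\setminus S$. Splits. A split of a connected graph is a bipartition $(A,B)$ of its vertex set with $|A|,|B|>1$ such that every vertex of $N(B)$ is adjacent to every vertex of $N(A)$. A star is a graph with at least three vertices having one vertex (its centre) adjacent to all others and no other edges. Cliques (complete graphs) and stars are degenerate; a graph with no split that is not degenerate is prime. Graph-labelled trees. A graph-labelled tree (GLT) $(T,\mathcal F)$ is a tree $T$ whose non-leaf vertices are called nodes (each of degree at least 3), where each node $u$ is labelled by a graph $G(u)\in\mathcal F$ together with a bijection $\rho_u$ from the tree-edges incident to $u$ to $V(u):=V(G(u))$. A node is called clique, star, prime, degenerate according to its label. Vertices of labels are marker vertices; edges of labels are label-edges. The extremities of a tree-edge $e$ are: at an end that is a node $u$, the marker vertex $\rho_u(e)$; at an end that is a leaf, the leaf itself. The two extremities of a tree-edge are opposite to each other. Two elements (leaves or marker vertices) are accessible from one another if there is a sequence of leaves and marker vertices joining them whose consecutive elements are either the two extremities of a tree-edge or the two vertices of a label-edge, with tree-edges and label-edges alternating. The accessibility graph of the GLT has the leaves of $T$ as vertices, distinct leaves being adjacent iff accessible from one another. (The GLT of $K_2$ is one edge between two leaves.) Node-joins. For a tree-edge between nodes $u,u'$ with extremities $q\in V(u)$, $q'\in V(u')$, the node-join replaces $u,u'$ by one node labelled by the graph obtained from $G(u)$ and $G(u')$ by adding all edges between $N(q)$ and $N(q')$ and deleting $q,q'$. It is a clique-join if both labels are cliques, and a star-join if both are stars and exactly one of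 $q,q'$ is the centre of its star. A GLT is reduced if all its labels are prime or degenerate and no clique-join or star-join is possible. Every connected graph $G$ is the accessibility graph of a unique reduced GLT, the split-tree $ST(G)$. States. For a marker vertex $q\in V(u)$ corresponding to the tree-edge $e$, $L(q)$ is the set of leaves in the component of $T-e$ not containing $u$, and $A(q)$ is the set of leaves of $L(q)$ accessible from $q$. For a leaf $\ell$, $L(\ell)$ is the set of all other leaves and $A(\ell)=N_G(\ell)$. With respect to a set $S$ of leaves, a leaf or marker vertex $q$ is perfect if $S\cap L(q)=A(q)$, empty if $S\cap L(q)=\emptyset$, and mixed otherwise. A tree-edge is $PP$ if both its extremities are perfect, $PE$ if one is perfect and the other empty, and fully-mixed if both are mixed (tree-edges incident to leaves are included, a leaf being an extremity). A node $u$ is hybrid if every $q\in V(u)$ is perfect or empty and the opposite of every $q\in V(u)$ is mixed. A fully-mixed subtree of $T$ is a subtree that contains at least one tree-edge, all of whose tree-edges are fully-mixed, and that is maximal for inclusion with this property. -}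

module Defs where

open import Data.Empty using (⊥)
open import Data.Fin.Base using (Fin; zero; suc; inject₁; fromℕ)
open import Data.Fin.Patterns using (0F; 1F; 2F; 3F; 4F; 5F; 6F)
open import Data.Fin.Subset using (Subset; ∁; ∣_∣; _∈_; _∉_)
open import Data.Nat.Base using (ℕ; _+_; _≤_; _<_)
open import Data.Product using (Σ; ∃; ∃!; _×_; _,_; proj₁; proj₂)
open import Data.Sum.Base using (_⊎_; inj₁; inj₂; swap)
open import Function.Base using (_∘_)
open import Function.Bundles using (_↔_; _⇔_; Inverse)
open import Function.Definitions using (Injective)
open import Level using (Level; 0ℓ)
open import Relation.Binary.Construct.Closure.ReflexiveTransitive using () renaming (Star to Walk)
open import Relation.Binary.Core using (Rel; _⇒_)
open import Relation.Binary.Definitions using (Decidable; Irrelevant; Irreflexive; Symmetric)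
open import Relation.Binary.PropositionalEquality using (_≡_; _≢_; refl; sym)
open import Relation.Nullary using (¬_)
open import Relation.Unary using (Pred; _∩_; _⊆_; _≐_; Empty)

-- Only instantiated at finite vertex types.  Irrelevance makes edges simple:
-- the edges incident to x correspond to its neighbours.
record Graph (V : Set) : Set₁ where
  infix 4 _~_
  field
    _~_          : Rel V 0ℓ
    ~-dec        : Decidable _~_
    ~-irrelevant : Irrelevant _~_
    ~-sym        : Symmetric _~_
    ~-irrefl     : Irreflexive _≡_ _~_

module _ {V : Set} (G : Graph V) where
  open Graph G

  Connected : Set
  Connected = ∀ x y → Walk _~_ x y

  record Cycle : Set where
    field
      {k}       : ℕ
      vertex    : Fin (3 + k) → V
      injective : Injective _≡_ _≡_ vertex
      step      : ∀ i → vertex (inject₁ i) ~ vertex (suc i)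
      close     : vertex (fromℕ (2 + k)) ~ vertex zero

  IsTree : Set
  IsTree = Connected × ¬ Cycle

module _ {k : ℕ} (G : Graph (Fin k)) where
  open Graph G

  Neighbourhood : Subset k → Pred (Fin k) 0ℓ
  Neighbourhood A x = x ∉ A × ∃ λ y → y ∈ A × y ~ x

  -- The bipartition (A , ∁ A).
  IsSplit : Subset k → Set
  IsSplit A = 1 < ∣ A ∣ × 1 < ∣ ∁ A ∣ ×
    (∀ {x y} → Neighbourhood (∁ A) x → Neighbourhood A y → x ~ y)

  IsClique : Set
  IsClique = ∀ {x y} → x ≢ y → x ~ y

  IsStarWithCentre : Fin k → Set
  IsStarWithCentre c = 3 ≤ k × (∀ {x} → x ≢ c → c ~ x) ×
    (∀ {x y} → x ~ y → x ≡ c ⊎ y ≡ c)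

  IsStar : Set
  IsStar = ∃ IsStarWithCentre

  IsDegenerate : Set
  IsDegenerate = IsClique ⊎ IsStar

  -- Splits are a notion for connected graphs, hence the first conjunct.
  IsPrime : Set
  IsPrime = Connected G × (∀ A → ¬ IsSplit A) × ¬ IsDegenerate

data Vertex (n p : ℕ) : Set where
  leaf : Fin n → Vertex n p
  node : Fin p → Vertex n p

-- A graph-labelled tree with n leaves and p nodes.  The leaves are exactly the
-- vertices of degree 1.  A tree-edge incident to the node u is given by its
-- other end, so ρ also makes `deg u` the degree of u.
record GLT (n p : ℕ) : Set₁ where
  field
    tree   : Graph (Vertex n p)
  open Graph tree public
  field
    isTree   : IsTree tree
    leaf-deg : ∀ ℓ → ∃! _≡_ (leaf ℓ ~_)
    deg      : Fin p → ℕ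
    deg≥3    : ∀ u → 3 ≤ deg u
    label    : ∀ u → Graph (Fin (deg u))
    ρ        : ∀ u → (∃ λ t → node u ~ t) ↔ Fin (deg u)

module Accessibility {n p : ℕ} (𝒯 : GLT n p) where
  open GLT 𝒯

  -- An oriented presentation of a tree-edge; `_≈ᴱ_` forgets the orientation.
  record TreeEdge : Set where
    constructor edge
    field
      src tgt : Vertex n p
      src~tgt : src ~ tgt
  open TreeEdge public

  reverse : TreeEdge → TreeEdge
  reverse (edge s t e) = edge t s (~-sym e)

  HasEnds : TreeEdge → Rel (Vertex n p) 0ℓ
  HasEnds e x y = (src e ≡ x × tgt e ≡ y) ⊎ (src e ≡ y × tgt e ≡ x)

  infix 4 _≈ᴱ_
  _≈ᴱ_ : Rel TreeEdge 0ℓ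
  e ≈ᴱ f = HasEnds e (src f) (tgt f)

  data Element : Set where
    leaf   : Fin n → Element
    marker : (u : Fin p) → Fin (deg u) → Element

  -- The extremity of a tree-edge at its source.
  extremity : TreeEdge → Element
  extremity (edge (leaf ℓ) t e) = leaf ℓ
  extremity (edge (node u) t e) = marker u (Inverse.to (ρ u) (t , e))

  -- The tree-edge of which an element is an extremity, oriented away from it.
  edgeOf : Element → TreeEdge
  edgeOf (leaf ℓ)     = edge (leaf ℓ) (proj₁ (leaf-deg ℓ)) (proj₁ (proj₂ (leaf-deg ℓ)))
  edgeOf (marker u q) = let (t , e) = Inverse.from (ρ u) q in edge (node u) t e

  opposite : Element → Element
  opposite = extremity ∘ reverse ∘ edgeOf

  data LabelEdge : Rel Element 0ℓ where
    labelEdge : ∀ {u q r} → Graph._~_ (label u) q r → LabelEdge (marker u q) (marker u r)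

  data StepKind : Set where
    tree-step label-step : StepKind

  -- Alternating sequences, indexed by the kind of step allowed first.
  data Alternating : StepKind → Rel Element 0ℓ where
    []      : ∀ {κ x} → Alternating κ x x
    via-tree  : ∀ {x y} → Alternating label-step (opposite x) y → Alternating tree-step x y
    via-label : ∀ {x y z} → LabelEdge x y → Alternating tree-step y z → Alternating label-step x z

  Accessible : Rel Element 0ℓ
  Accessible x y = ∃ λ κ → Alternating κ x y

  -- A join is performed on a tree-edge between two nodes u and v.
  CliqueJoinPossible : Set
  CliqueJoinPossible = ∃ λ u → ∃ λ v → node u ~ node v × IsClique (label u) × IsClique (label v)

  -- c and d are the centres, q and r the extremities of the tree-edge.
  StarJoinPossible : Set
  StarJoinPossible =
    ∃ λ u → ∃ λ v → Σ (node u ~ node v) λ e → ∃ λ c → ∃ λ d →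
      IsStarWithCentre (label u) c × IsStarWithCentre (label v) d ×
      (let q = Inverse.to (ρ u) (node v , e)
           r = Inverse.to (ρ v) (node u , ~-sym e)
       in (q ≡ c × r ≢ d) ⊎ (q ≢ c × r ≡ d))

  IsReduced : Set
  IsReduced = (∀ u → IsPrime (label u) ⊎ IsDegenerate (label u)) ×
    ¬ CliqueJoinPossible × ¬ StarJoinPossible

-- The split-tree of G is the reduced graph-labelled tree having G as its
-- accessibility graph; the vertices of G are themselves the leaves.
IsSplitTreeOf : ∀ {n p} → GLT n p → Graph (Fin n) → Set
IsSplitTreeOf 𝒯 G = IsReduced ×
  (∀ x y → Graph._~_ G x y ⇔ (x ≢ y × Accessible (leaf x) (leaf y)))
  where open Accessibility 𝒯

module Subgraphs {V : Set} (G : Graph V) where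
  open Graph G

  -- Membership is an arbitrary predicate so that subgraphs cut out by
  -- conditions on states need no decision procedure.
  record Subgraph : Set₁ where
    field
      Vtx    : Pred V 0ℓ
      Edg    : Rel V 0ℓ
      Edg⊆~  : ∀ {x y} → Edg x y → x ~ y
      Edg⊆V  : ∀ {x y} → Edg x y → Vtx x
      Edgsym : Symmetric Edg
  open Subgraph public

  infix 4 _⊑_ _≈_
  _⊑_ _≈_ : Subgraph → Subgraph → Set
  H ⊑ K = Vtx H ⊆ Vtx K × Edg H ⇒ Edg K
  H ≈ K = H ⊑ K × K ⊑ H

  IsConnected : Subgraph → Set
  IsConnected H = ∀ {x y} → Vtx H x → Vtx H y → Walk (Edg H) x y

-- P has x as its only solution up to ∼; `∃ (IsUnique _∼_ P)` is `∃! _∼_ P`.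
IsUnique : ∀ {a b ℓ : Level} {A : Set a} → Rel A ℓ → Pred A b → Pred A _
IsUnique _∼_ P x = P x × (∀ {y} → P y → x ∼ y)

module Marked {n p : ℕ} (G : Graph (Fin n)) (𝒯 : GLT n p) (S : Subset n) where
  open GLT 𝒯
  open Accessibility 𝒯
  open Subgraphs tree

  Without : TreeEdge → Rel (Vertex n p) 0ℓ
  Without e x y = x ~ y × ¬ HasEnds e x y

  -- For a marker vertex q of u: the leaves not in the component of node u
  -- once the tree-edge of q is removed.
  L : Element → Pred (Fin n) 0ℓ
  L (leaf ℓ)     x = x ≢ ℓ
  L (marker u q) x = ¬ Walk (Without (edgeOf (marker u q))) (node u) (leaf x)

  A : Element → Pred (Fin n) 0ℓ
  A (leaf ℓ)     = Graph._~_ G ℓ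
  A (marker u q) = L (marker u q) ∩ (λ x → Accessible (marker u q) (leaf x))

  IsPerfect IsEmpty IsMixed : Pred Element 0ℓ
  IsPerfect q = (_∈ S) ∩ L q ≐ A q
  IsEmpty q   = Empty ((_∈ S) ∩ L q)
  IsMixed q   = ¬ IsPerfect q × ¬ IsEmpty q

  PP PE FullyMixed : Pred TreeEdge 0ℓ
  PP e = IsPerfect (extremity e) × IsPerfect (extremity (reverse e))
  PE e = (IsPerfect (extremity e) × IsEmpty (extremity (reverse e)))
       ⊎ (IsEmpty (extremity e) × IsPerfect (extremity (reverse e)))
  FullyMixed e = IsMixed (extremity e) × IsMixed (extremity (reverse e))

  PerfectClique PerfectCentreStar Hybrid : Pred (Fin p) 0ℓ
  PerfectClique u     = IsClique (label u) × (∀ q → IsPerfect (marker u q))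
  PerfectCentreStar u = ∃ λ c → IsStarWithCentre (label u) c × IsPerfect (marker u c) ×
    (∀ {q} → q ≢ c → IsEmpty (marker u q))
  Hybrid u = ∀ q → (IsPerfect (marker u q) ⊎ IsEmpty (marker u q)) × IsMixed (opposite (marker u q))

  -- A connected subgraph of a tree is a subtree: acyclicity is inherited.
  IsFullyMixed : Pred Subgraph 0ℓ
  IsFullyMixed H = IsConnected H × (∃ λ x → ∃ λ y → Edg H x y) ×
    (∀ e → Edg H (src e) (tgt e) → FullyMixed e)

  FullyMixedSubtree : Subgraph → Set₁
  FullyMixedSubtree H = IsFullyMixed H × (∀ K → IsFullyMixed K → H ⊑ K → K ⊑ H)

  nodeAlone : Fin p → Subgraph
  nodeAlone u = record
    { Vtx = _≡ node u ; Edg = λ _ _ → ⊥ ; Edg⊆~ = λ () ; Edg⊆V = λ () ; Edgsym = λ () }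

  -- The node u, its incident tree-edges, and the other ends of these.
  nodeWithEdges : Fin p → Subgraph
  nodeWithEdges u = record
    { Vtx    = λ x → x ≡ node u ⊎ node u ~ x
    ; Edg    = λ x y → x ~ y × (x ≡ node u ⊎ y ≡ node u)
    ; Edg⊆~  = proj₁
    ; Edg⊆V  = λ { (_ , inj₁ x≡u) → inj₁ x≡u ; (e , inj₂ refl) → inj₂ (~-sym e) }
    ; Edgsym = λ (e , at-u) → ~-sym e , swap at-u
    }

  edgeAlone : TreeEdge → Subgraph
  edgeAlone e = record
    { Vtx    = λ x → x ≡ src e ⊎ x ≡ tgt e
    ; Edg    = HasEnds e
    ; Edg⊆~  = λ { (inj₁ (refl , refl)) → src~tgt e ; (inj₂ (refl , refl)) → ~-sym (src~tgt e) }
    ; Edg⊆V  = λ { (inj₁ (x≡s , _)) → inj₁ (sym x≡s) ; (inj₂ (_ , x≡t)) → inj₂ (sym x≡t) }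
    ; Edgsym = swap
    }

  -- e together with its target must be deleted.
  Discards : Pred TreeEdge 0ℓ
  Discards e = (IsPerfect (extremity e) ⊎ IsEmpty (extremity e)) × IsMixed (extremity (reverse e))

  -- What is left of the tree after all these deletions; deleting a vertex
  -- deletes its incident tree-edges as well.
  remainder : Subgraph
  remainder = record
    { Vtx    = Kept
    ; Edg    = λ x y → Kept x × Kept y × Σ (x ~ y) λ _ →
                 ∀ e → HasEnds e x y → ¬ Discards e
    ; Edg⊆~  = λ (_ , _ , e , _) → e
    ; Edg⊆V  = proj₁
    ; Edgsym = λ (kx , ky , e , keep) → ky , kx , ~-sym e , λ f ends → keep f (swap ends)
    }
    where
    Kept : Pred (Vertex n p) 0ℓ
    Kept x = ∀ e → tgt e ≡ x → ¬ Discards e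

  -- Condition i H: the condition numbered i holds (counting from 0), and H is
  -- the subgraph that its unique node, tree-edge or subtree stands for.
  data Condition : Fin 7 → Subgraph → Set₁ where
    clique-node : ∀ {u} → IsUnique _≡_ PerfectClique u → Condition 0F (nodeWithEdges u)
    star-node   : ∀ {u} → IsUnique _≡_ PerfectCentreStar u → Condition 1F (nodeWithEdges u)
    prime-hybrid : ∀ {u} → IsUnique _≡_ Hybrid u → IsPrime (label u) → Condition 2F (nodeAlone u)
    degenerate-hybrid : ∀ {u} → IsUnique _≡_ Hybrid u → IsDegenerate (label u) → Condition 3F (nodeAlone u)
    PP-edge : ∀ {e} → IsUnique _≈ᴱ_ PP e → Condition 4F (edgeAlone e)
    PE-edge : ∀ {e} → IsUnique _≈ᴱ_ PE e → Condition 5F (edgeAlone e)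
    fully-mixed : ∀ {H} → IsUnique _≈_ FullyMixedSubtree H → Condition 6F H

{-# OPTIONS --safe #-}
module Submission where

-- Call an extremity pure when it is perfect or empty.  At a node, the opposite of a
-- marker is perfect (empty) iff the other markers are perfect at its neighbours and
-- empty elsewhere (all empty).  Hence purity is inherited by the tree-edges further
-- away, deletions propagate outwards, and the remainder is a subtree whose tree-edges
-- are those that are not pure at exactly one extremity.  A fully-mixed tree-edge and a
-- tree-edge pure at both extremities exclude each other.  Two adjacent tree-edges pure
-- at both extremities give twins, or a pendant marker and its neighbour, in the label of
-- their common node; such a label is degenerate, the node is as in case 1 or 2, and no
-- neighbouring node is of this kind because no clique-join or star-join is possible.
-- If every tree-edge is pure at exactly one extremity, following the mixed extremities
-- ends at the hybrid node.

open import Defs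
open import Data.Empty using (⊥; ⊥-elim)
open import Data.Fin.Base using (Fin; zero; suc; toℕ; join; combine; splitAt)
open import Data.Fin.Induction using (spo-wellFounded)
open import Data.Fin.Patterns using (0F; 1F; 2F; 3F; 4F; 5F; 6F)
open import Data.Fin.Properties as Finₚ using (any?; all?; toℕ<n; toℕ-inject₁; toℕ-fromℕ; toℕ-injective; combine-injective; splitAt-join)
open import Data.Fin.Subset using (Subset; Nonempty; ∁; ∣_∣; ⁅_⁆; _∪_; _∈_; _∉_)
open import Data.Fin.Subset.Properties using (_∈?_; ∣⁅x⁆∣≡1; p⊂q⇒∣p∣<∣q∣; x∈⁅x⁆; x∈⁅y⁆⇒x≡y; x∈p∪q⁺; x∈p∪q⁻; x∉p⇒x∈∁p; x∈∁p⇒x∉p; x∉∁p⇒x∈p)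
open import Data.Nat.Base using (ℕ; zero; suc; _+_; _*_; _∸_; _≤_; _<_; z≤n; s≤s)
open import Data.Nat.Induction using (<-rec)
open import Data.Nat.Properties using (<-cmp; m∸n+n≡m; m∸n≤m; ≤-trans; ≤-pred; +-monoˡ-≤; <⇒≤)
open import Data.Product as Product using (∃; ∃₂; ∃!; _×_; _,_; proj₁; proj₂)
open import Data.Sum.Base as Sum using (_⊎_; inj₁; inj₂)
open import Function.Base using (_∘_)
open import Function.Bundles using (Equivalence; Inverse)
open import Induction.WellFounded using (Acc; acc; WellFounded; module Subrelation)
open import Level using (0ℓ)
open import Relation.Binary.Construct.Closure.ReflexiveTransitive using (Star; ε; _◅_; _◅◅_)
open import Relation.Binary.Core using (Rel)
open import Relation.Binary.Definitions using (DecidableEquality; tri<; tri≈; tri>)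
open import Relation.Binary.PropositionalEquality using (_≡_; _≢_; refl; sym; trans; cong; subst; subst₂; isEquivalence; module ≡-Reasoning)
open import Relation.Binary.Structures using (IsStrictPartialOrder)
open import Relation.Nullary using (¬_; Dec; yes; no; contradiction)
open import Relation.Nullary.Decidable using (map′; toSum; decidable-stable; ¬?; _×-dec_; _⊎-dec_; _→-dec_)
import Relation.Binary.Construct.On as On

-- Equality of tree vertices.

leaf-injective : ∀ {n p} {i j : Fin n} → leaf {n} {p} i ≡ leaf j → i ≡ j
leaf-injective refl = refl

node-injective : ∀ {n p} {u v : Fin p} → node {n} {p} u ≡ node v → u ≡ v
node-injective refl = refl

infix 4 _≟ⱽ_
_≟ⱽ_ : ∀ {n p} → DecidableEquality (Vertex n p)
leaf i ≟ⱽ leaf j = map′ (cong leaf) leaf-injective (i Finₚ.≟ j)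
leaf i ≟ⱽ node v = no λ ()
node u ≟ⱽ leaf j = no λ ()
node u ≟ⱽ node v = map′ (cong node) node-injective (u Finₚ.≟ v)

-- Chains of directed tree-edges and the branches beyond them.

module Branches {n p : ℕ} (𝒯 : GLT n p) where
  open GLT 𝒯
  open Accessibility 𝒯

  infix 4 _▹_ _▹*_
  -- Succession without backtracking. As the tree has no cycle, `e ▹* f` means that `f` is `e` or
  -- lies beyond `e` and is directed away from it.
  record _▹_ (e f : TreeEdge) : Set where
    constructor _,_
    field
      tgt≡src : tgt e ≡ src f
      tgt≢src : tgt f ≢ src e
  open _▹_

  _▹*_ : Rel TreeEdge 0ℓ
  _▹*_ = Star _▹_

  edge-≡ : ∀ {e f} → src e ≡ src f → tgt e ≡ tgt f → e ≡ f
  edge-≡ {edge s t e} {edge _ _ f} refl refl = cong (edge s t) (~-irrelevant e f)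

  reverse-involutive : ∀ e → reverse (reverse e) ≡ e
  reverse-involutive e = edge-≡ refl refl

  ≈ᴱ⇒≡ : ∀ {e f} → e ≈ᴱ f → e ≡ f ⊎ e ≡ reverse f
  ≈ᴱ⇒≡ (inj₁ (s , t)) = inj₁ (edge-≡ s t)
  ≈ᴱ⇒≡ (inj₂ (s , t)) = inj₂ (edge-≡ s t)

  ▹-reverse : ∀ {e f} → e ▹ f → reverse f ▹ reverse e
  ▹-reverse (t≡s , t≢s) = sym t≡s , t≢s ∘ sym

  ▹*-reverse : ∀ {e f} → e ▹* f → reverse f ▹* reverse e
  ▹*-reverse ε = ε
  ▹*-reverse (d ◅ c) = ▹*-reverse c ◅◅ (▹-reverse d ◅ ε)

  -- Indexing by `ℕ` lets a segment be cut out by shifting the index, as the cycle argument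
  -- requires; the values after `d` are never looked at.
  toSequence : ∀ {e f} → e ▹* f →
    ∃₂ λ d (E : ℕ → TreeEdge) → E 0 ≡ e × E d ≡ f × (∀ i → i < d → E i ▹ E (suc i))
  toSequence {e} ε = 0 , (λ _ → e) , refl , refl , λ _ ()
  toSequence {e} (e▹g ◅ c) with d , E , refl , E-d , steps ← toSequence c =
    suc d , E′ , refl , E-d , λ { zero _ → e▹g ; (suc i) (s≤s i<d) → steps i i<d }
    where
    E′ : ℕ → TreeEdge
    E′ zero    = e
    E′ (suc i) = E i

  -- By induction all vertices but the last are distinct, so a closed sequence is a cycle.
  sequence-open : ∀ d (E : ℕ → TreeEdge) → (∀ i → i < d → E i ▹ E (suc i)) →
    src (E 0) ≢ tgt (E d)
  sequence-open = <-rec _ go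
    where
    Open : ℕ → Set
    Open d = ∀ (E : ℕ → TreeEdge) → (∀ i → i < d → E i ▹ E (suc i)) → src (E 0) ≢ tgt (E d)

    go : ∀ d → (∀ {k} → k < d → Open k) → Open d
    go zero          _  E steps closed = ~-irrefl closed (src~tgt (E 0))
    -- Two tree-edges that close up would backtrack; from three on, a closed sequence has enough
    -- vertices for a `Cycle`.
    go (suc zero)    _  E steps closed = tgt≢src (steps 0 (s≤s z≤n)) (sym closed)
    go (suc (suc k)) ih E steps closed = proj₂ isTree record
      { vertex    = vertex
      ; injective = λ {i} {j} → injective i j
      ; step      = λ i → subst (λ m → src (E m) ~ src (E (suc (toℕ i)))) (sym (toℕ-inject₁ i))
                      (subst (src (E (toℕ i)) ~_) (tgt≡src (steps _ (toℕ<n i))) (src~tgt (E (toℕ i))))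
      ; close     = subst (λ m → src (E m) ~ src (E 0)) (sym (toℕ-fromℕ (2 + k)))
                      (subst (src (E (2 + k)) ~_) (sym closed) (src~tgt (E (2 + k))))
      }
      where
      vertex : Fin (3 + k) → Vertex n p
      vertex i = src (E (toℕ i))

      -- For an index `suc b` the vertex `src (E (suc b))` is the target of `E b`, so a coincidence
      -- closes the segment from `a` to `b`, of length `b ∸ a`.
      distinct : ∀ {a} b → a < b → b ≤ 2 + k → src (E a) ≢ src (E b)
      distinct {a} (suc b) (s≤s a≤b) b<2+k eq = ih {b ∸ a} (≤-trans (s≤s (m∸n≤m b a)) b<2+k)
        (λ i → E (i + a))
        (λ i i<b∸a → steps _ (≤-trans
          (subst (suc (i + a) ≤_) (m∸n+n≡m a≤b) (+-monoˡ-≤ a i<b∸a)) (<⇒≤ b<2+k)))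
        (trans eq (trans (sym (tgt≡src (steps _ b<2+k))) (cong (tgt ∘ E) (sym (m∸n+n≡m a≤b)))))

      injective : ∀ i j → vertex i ≡ vertex j → i ≡ j
      injective i j eq with <-cmp (toℕ i) (toℕ j)
      ... | tri< i<j _ _ = contradiction eq (distinct (toℕ j) i<j (≤-pred (toℕ<n j)))
      ... | tri≈ _ i≡j _ = toℕ-injective i≡j
      ... | tri> _ _ j<i = contradiction (sym eq) (distinct (toℕ i) j<i (≤-pred (toℕ<n i)))

  no-return : ∀ {e f} → e ▹* f → src e ≢ tgt f
  no-return c with d , E , refl , refl , steps ← toSequence c = sequence-open d E steps

  ▹*-unsnoc : ∀ {e f g} → e ▹ f → f ▹* g → ∃ λ h → e ▹* h × h ▹ g
  ▹*-unsnoc e▹f ε         = _ , ε , e▹f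
  ▹*-unsnoc e▹f (f▹h ◅ c) with _ , c′ , last ← ▹*-unsnoc f▹h c = _ , e▹f ◅ c′ , last

  no-return⁺ : ∀ {e f g} → e ▹ f → f ▹* g → src e ≢ src g
  no-return⁺ e▹f c eq with _ , c′ , t≡s , _ ← ▹*-unsnoc e▹f c = no-return c′ (trans eq (sym t≡s))

  vertexSum : Vertex n p → Fin n ⊎ Fin p
  vertexSum (leaf ℓ) = inj₁ ℓ
  vertexSum (node u) = inj₂ u

  vertexSum-injective : ∀ {x y} → vertexSum x ≡ vertexSum y → x ≡ y
  vertexSum-injective {leaf _} {leaf _} refl = refl
  vertexSum-injective {node _} {node _} refl = refl

  vertexCode : Vertex n p → Fin (n + p)
  vertexCode x = join n p (vertexSum x)

  vertexCode-injective : ∀ {x y} → vertexCode x ≡ vertexCode y → x ≡ y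
  vertexCode-injective {x} {y} eq = vertexSum-injective (begin
    vertexSum x              ≡⟨ splitAt-join n p (vertexSum x) ⟨
    splitAt n (vertexCode x) ≡⟨ cong (splitAt n) eq ⟩
    splitAt n (vertexCode y) ≡⟨ splitAt-join n p (vertexSum y) ⟩
    vertexSum y              ∎)
    where open ≡-Reasoning

  edgeCode : TreeEdge → Fin ((n + p) * (n + p))
  edgeCode e = combine (vertexCode (src e)) (vertexCode (tgt e))

  edgeCode-injective : ∀ e f → edgeCode e ≡ edgeCode f → e ≡ f
  edgeCode-injective e f eq with s , t ← combine-injective (vertexCode (src e)) (vertexCode (tgt e)) _ _ eq =
    edge-≡ (vertexCode-injective s) (vertexCode-injective t)

  infix 4 _◂_
  _◂_ : Rel TreeEdge 0ℓ
  f ◂ e = e ▹ f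

  abstract
    -- No chain returns to its start, so the transitive closure of `_▹_` is a strict order;
    -- tree-edges embed in a `Fin`, where strict partial orders are well-founded. This justifies
    -- recursion from a tree-edge to those beyond it.
    ◂-wellFounded : WellFounded _◂_
    ◂-wellFounded = Subrelation.wellFounded
      (λ {f} {e} e▹f → e , f , refl , refl , f , e▹f , ε)
      (On.wellFounded edgeCode (spo-wellFounded {_⊏_ = _⊏_} ⊏-isStrictPartialOrder))
      where
      -- Not every number is the code of a tree-edge, so codes are compared through tree-edges
      -- having them.
      _⊏_ : Rel (Fin ((n + p) * (n + p))) 0ℓ
      i ⊏ j = ∃₂ λ e f → edgeCode e ≡ j × edgeCode f ≡ i × ∃ λ g → e ▹ g × g ▹* f

      ⊏-isStrictPartialOrder : IsStrictPartialOrder _≡_ _⊏_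
      ⊏-isStrictPartialOrder = record
        { isEquivalence = isEquivalence
        ; irrefl = λ { refl (e , f , e≡ , f≡ , g , e▹g , c) →
            no-return⁺ e▹g c (cong src (edgeCode-injective e f (trans e≡ (sym f≡)))) }
        ; trans = λ (e , f , e≡ , f≡ , g , e▹g , c) (e′ , f′ , e′≡ , f′≡ , g′ , e′▹g′ , c′) →
            e′ , f , e′≡ , f≡ , g′ , e′▹g′ ,
            c′ ◅◅ subst (_▹ g) (edgeCode-injective e f′ (trans e≡ (sym f′≡))) e▹g ◅ c
        ; <-resp-≈ = (λ { refl r → r }) , λ { refl r → r }
        }

  -- A walk is turned into a chain step by step: a step back along the last tree-edge removes it,
  -- any other step prolongs the chain.
  reach-vertex : ∀ w x → x ≡ w ⊎ ∃₂ λ e f → src e ≡ w × e ▹* f × tgt f ≡ x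
  reach-vertex w x = extend (proj₁ isTree w x) (inj₁ refl)
    where
    Reached : Vertex n p → Set
    Reached x = x ≡ w ⊎ ∃₂ λ e f → src e ≡ w × e ▹* f × tgt f ≡ x

    extend : ∀ {y x} → Star _~_ y x → Reached y → Reached x
    extend ε         r = r
    extend (a ◅ ws) (inj₁ y≡w) = extend ws (inj₂ (_ , edge _ _ a , y≡w , ε , refl))
    extend {y} (_◅_ {j = z} a ws) (inj₂ (e , f , s , c , t)) with z ≟ⱽ src f
    ... | no z≢  = extend ws (inj₂ (e , edge y z a , s , c ◅◅ (t , z≢) ◅ ε , refl))
    ... | yes refl with c
    ...   | ε = extend ws (inj₁ s)
    ...   | d ◅ c′ with h , c″ , t′ , _ ← ▹*-unsnoc d c′ = extend ws (inj₂ (e , h , s , c″ , t′))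

  reach-edge : ∀ w f → ∃ λ e → src e ≡ w × (e ▹* f ⊎ e ▹* reverse f)
  reach-edge w f with reach-vertex w (src f)
  ... | inj₁ s = f , s , inj₁ ε
  ... | inj₂ (e , g , s , c , t) with tgt f ≟ⱽ src g
  ...   | no t≢   = e , s , inj₁ (c ◅◅ (t , t≢) ◅ ε)
  ...   | yes t≡s = e , s , inj₂ (subst (e ▹*_) (edge-≡ (sym t≡s) t) c)

  -- The component of `tgt e` in the tree without `e`, given by chains so that it can be decomposed
  -- at each node.
  Beyond : TreeEdge → Vertex n p → Set
  Beyond e x = ∃ λ f → e ▹* f × tgt f ≡ x

  beyond-▹ : ∀ {e f x} → e ▹ f → Beyond f x → Beyond e x
  beyond-▹ d (g , c , t) = g , d ◅ c , t

  -- Reversing one chain and appending the other yields a chain through `e` from `x` back to `x`.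
  beyond-disjoint : ∀ {e x} → Beyond e x → ¬ Beyond (reverse e) x
  beyond-disjoint {e} (f , c , refl) (g , c′ , t) =
    no-return (subst (reverse g ▹*_) (reverse-involutive e) (▹*-reverse c′) ◅◅ c) t

  beyond-total : ∀ e x → Beyond e x ⊎ Beyond (reverse e) x
  beyond-total e x with reach-vertex (src e) x
  ... | inj₁ refl = inj₂ (reverse e , ε , refl)
  ... | inj₂ (f , g , s , c , t) with tgt f ≟ⱽ tgt e
  ...   | yes t≡ = inj₁ (g , subst (_▹* g) (edge-≡ s t≡) c , t)
  ...   | no t≢  = inj₂ (g , (sym s , t≢) ◅ c , t)

  -- If `f` and `g` differ, `g` continues `reverse f`, and `x` would lie on both sides of `f`.
  beyond-siblings : ∀ {e f g x} → e ▹ f → e ▹ g → Beyond f x → Beyond g x → f ≡ g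
  beyond-siblings {f = f} {g} (t≡s , _) (t≡s′ , _) b b′ with tgt g ≟ⱽ tgt f
  ... | yes t≡ = edge-≡ (trans (sym t≡s) t≡s′) (sym t≡)
  ... | no t≢  = ⊥-elim (beyond-disjoint b (beyond-▹ (trans (sym t≡s) t≡s′ , t≢) b′))

  beyond-step : ∀ {e x y} → Beyond e x → x ~ y → Beyond e y ⊎ HasEnds e x y
  beyond-step {e} {x} {y} (f , c , t) x~y with y ≟ⱽ src f
  ... | no y≢ = inj₁ (edge x y x~y , c ◅◅ (t , y≢) ◅ ε , refl)
  beyond-step (f , ε , t) x~y | yes refl = inj₂ (inj₂ (refl , t))
  beyond-step (f , d ◅ c , t) x~y | yes refl with h , c′ , t≡s , _ ← ▹*-unsnoc d c =
    inj₁ (h , c′ , t≡s)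

  -- With its converse below, this identifies `Beyond` with the components in the definition of `L`;
  -- the relation is `Without e` written out.
  beyond⇒walk : ∀ {e x} → Beyond (reverse e) x → Star (λ y z → y ~ z × ¬ HasEnds e y z) (src e) x
  beyond⇒walk {e} (f , c , refl) = walk ε c
    where
    walk : ∀ {g} → reverse e ▹* g → g ▹* f → Star (λ y z → y ~ z × ¬ HasEnds e y z) (tgt g) (tgt f)
    walk c₀ ε = ε
    walk c₀ (_◅_ {j = h} g▹h@(refl , _) c) =
      (src~tgt h , λ { (inj₁ (_ , t≡t)) → no-return (c₀ ◅◅ g▹h ◅ ε) t≡t
                     ; (inj₂ (_ , t≡s)) → no-return c₀ t≡s }) ◅ walk (c₀ ◅◅ g▹h ◅ ε) c

  walk⇒beyond : ∀ {e x} → Star (λ y z → y ~ z × ¬ HasEnds e y z) (src e) x → Beyond (reverse e) x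
  walk⇒beyond {e} = go (reverse e , ε , refl)
    where
    go : ∀ {y x} → Beyond (reverse e) y → Star (λ y z → y ~ z × ¬ HasEnds e y z) y x → Beyond (reverse e) x
    go b ε = b
    go b ((y~z , other) ◅ ws) with beyond-step b y~z
    ... | inj₁ b′ = go b′ ws
    ... | inj₂ h  = ⊥-elim (other (Sum.swap (Sum.map Product.swap Product.swap h)))

  -- Tree-edges, their extremities and opposites.

  edgeOf-extremity : ∀ e → edgeOf (extremity e) ≡ e
  edgeOf-extremity (edge (leaf ℓ) t a) = edge-≡ refl (proj₂ (proj₂ (leaf-deg ℓ)) a)
  edgeOf-extremity (edge (node u) t a) =
    cong (λ (t , a) → edge (node u) t a) (Inverse.strictlyInverseʳ (ρ u) (t , a))

  extremity-edgeOf : ∀ a → extremity (edgeOf a) ≡ a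
  extremity-edgeOf (leaf ℓ)     = refl
  extremity-edgeOf (marker u q) = cong (marker u) (Inverse.strictlyInverseˡ (ρ u) q)

  edgeOf-opposite : ∀ a → edgeOf (opposite a) ≡ reverse (edgeOf a)
  edgeOf-opposite a = edgeOf-extremity _

  opposite-involutive : ∀ a → opposite (opposite a) ≡ a
  opposite-involutive a = begin
    extremity (reverse (edgeOf (opposite a))) ≡⟨ cong (extremity ∘ reverse) (edgeOf-opposite a) ⟩
    extremity (reverse (reverse (edgeOf a)))  ≡⟨ cong extremity (reverse-involutive _) ⟩
    extremity (edgeOf a)                      ≡⟨ extremity-edgeOf a ⟩
    a                                         ∎
    where open ≡-Reasoning

  marker-injective : ∀ {u q r} → marker u q ≡ marker u r → q ≡ r
  marker-injective refl = refl

  extremity-leaf : ∀ e {ℓ} → extremity e ≡ leaf ℓ → src e ≡ leaf ℓ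
  extremity-leaf (edge (leaf _) _ _) refl = refl

  at-node : ∀ e {u} → src e ≡ node u → ∃ λ q → e ≡ edgeOf (marker u q)
  at-node e@(edge (node u) t a) refl = _ , sym (edgeOf-extremity e)

  ▹-markers : ∀ {u q r} → q ≢ r → reverse (edgeOf (marker u r)) ▹ edgeOf (marker u q)
  ▹-markers {u} {q} {r} q≢r = refl , λ t≡t → q≢r (marker-injective (begin
    marker u q                      ≡⟨ extremity-edgeOf _ ⟨
    extremity (edgeOf (marker u q)) ≡⟨ cong extremity (edge-≡ refl t≡t) ⟩
    extremity (edgeOf (marker u r)) ≡⟨ extremity-edgeOf _ ⟩
    marker u r                      ∎))
    where open ≡-Reasoning

  ▹-marker⁻¹ : ∀ {u r f} → reverse (edgeOf (marker u r)) ▹ f → ∃ λ q → q ≢ r × f ≡ edgeOf (marker u q)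
  ▹-marker⁻¹ {f = f} (t≡s , t≢s) with q , refl ← at-node f (sym t≡s) = q , (λ { refl → t≢s refl }) , refl

  -- The case distinction for recursion outwards: the tree-edge of `a` ends at a leaf, or at a node
  -- whose other markers carry the next tree-edges.
  facing : ∀ a → (∃ λ ℓ → opposite a ≡ leaf ℓ) ⊎ ∃₂ λ u r → a ≡ opposite (marker u r)
  facing a with opposite a in eq
  ... | leaf ℓ     = inj₁ (ℓ , refl)
  ... | marker u r = inj₂ (u , r , trans (sym (opposite-involutive a)) (cong opposite eq))

  -- Every tree-edge is `edgeOf` of an extremity, so a search through the leaves and markers
  -- suffices.
  any-edge? : ∀ {Q : TreeEdge → Set} → (∀ e → Dec (Q e)) → Dec (∃ Q)
  any-edge? {Q} Q? = map′
    (λ { (inj₁ (ℓ , q)) → _ , q ; (inj₂ (u , r , q)) → _ , q })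
    (λ (e , q) → found (extremity e) (subst Q (sym (edgeOf-extremity e)) q))
    (any? (λ ℓ → Q? (edgeOf (leaf ℓ))) ⊎-dec any? (λ u → any? λ r → Q? (edgeOf (marker u r))))
    where
    found : ∀ a → Q (edgeOf a) →
      (∃ λ ℓ → Q (edgeOf (leaf ℓ))) ⊎ ∃₂ λ u r → Q (edgeOf (marker u r))
    found (leaf ℓ)     q = inj₁ (ℓ , q)
    found (marker u r) q = inj₂ (u , r , q)

-- Label graphs: three-vertex graphs, and labels with two inward markers.

third : ∀ {k} → 3 ≤ k → (x y : Fin k) → ∃ λ z → z ≢ x × z ≢ y
third (s≤s (s≤s (s≤s _))) 0F 0F = 1F , (λ ()) , λ ()
third (s≤s (s≤s (s≤s _))) 0F 1F = 2F , (λ ()) , λ ()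
third (s≤s (s≤s (s≤s _))) 0F (suc (suc _)) = 1F , (λ ()) , λ ()
third (s≤s (s≤s (s≤s _))) 1F 0F = 2F , (λ ()) , λ ()
third (s≤s (s≤s (s≤s _))) (suc (suc _)) 0F = 1F , (λ ()) , λ ()
third (s≤s (s≤s (s≤s _))) (suc _) (suc _) = 0F , (λ ()) , λ ()

distinct⇒1<∣∣ : ∀ {k} {A : Subset k} {x y} → x ≢ y → x ∈ A → y ∈ A → 1 < ∣ A ∣
distinct⇒1<∣∣ {A = A} {x} {y} x≢y x∈A y∈A = subst (_< ∣ A ∣) (∣⁅x⁆∣≡1 x)
  (p⊂q⇒∣p∣<∣q∣
    ( (λ z∈ → subst (_∈ A) (sym (x∈⁅y⁆⇒x≡y x z∈)) x∈A)
    , y , y∈A , λ y∈ → x≢y (sym (x∈⁅y⁆⇒x≡y x y∈))))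

module _ {k : ℕ} (K : Graph (Fin k)) where
  open Graph K

  neighbour : 3 ≤ k → IsPrime K ⊎ IsDegenerate K → ∀ r → ∃ λ q → r ~ q
  neighbour 3≤k kind r with other , other≢r , _ ← third 3≤k r r | kind
  ... | inj₁ (connected , _) with connected r other
  ...   | ε     = contradiction refl other≢r
  ...   | a ◅ _ = _ , a
  neighbour 3≤k kind r | inj₂ (inj₁ clique) = other , clique (other≢r ∘ sym)
  neighbour 3≤k kind r | inj₂ (inj₂ (c , _ , spoke , _)) with r Finₚ.≟ c
  ...   | yes refl = other , spoke other≢r
  ...   | no r≢c   = c , ~-sym (spoke r≢c)

  -- The pair `a`, `b` decides: a clique if adjacent, otherwise a star centred at `c`.
  covered-degenerate : ∀ {a b c} → 3 ≤ k → (∀ x → x ≡ a ⊎ x ≡ b ⊎ x ≡ c) →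
    c ~ a → c ~ b → IsDegenerate K
  covered-degenerate {a} {b} {c} 3≤k cover c~a c~b with ~-dec a b
  ... | yes a~b = inj₁ clique
    where
    clique : IsClique K
    clique {x} {y} x≢y with cover x | cover y
    ... | inj₁ refl        | inj₁ refl        = contradiction refl x≢y
    ... | inj₁ refl        | inj₂ (inj₁ refl) = a~b
    ... | inj₁ refl        | inj₂ (inj₂ refl) = ~-sym c~a
    ... | inj₂ (inj₁ refl) | inj₁ refl        = ~-sym a~b
    ... | inj₂ (inj₁ refl) | inj₂ (inj₁ refl) = contradiction refl x≢y
    ... | inj₂ (inj₁ refl) | inj₂ (inj₂ refl) = ~-sym c~b
    ... | inj₂ (inj₂ refl) | inj₁ refl        = c~a
    ... | inj₂ (inj₂ refl) | inj₂ (inj₁ refl) = c~b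
    ... | inj₂ (inj₂ refl) | inj₂ (inj₂ refl) = contradiction refl x≢y
  ... | no a≁b = inj₂ (c , 3≤k , spoke , at-centre)
    where
    spoke : ∀ {x} → x ≢ c → c ~ x
    spoke {x} x≢c with cover x
    ... | inj₁ refl        = c~a
    ... | inj₂ (inj₁ refl) = c~b
    ... | inj₂ (inj₂ x≡c)  = contradiction x≡c x≢c

    at-centre : ∀ {x y} → x ~ y → x ≡ c ⊎ y ≡ c
    at-centre {x} {y} x~y with cover x | cover y
    ... | inj₂ (inj₂ x≡c)  | _                = inj₁ x≡c
    ... | _                | inj₂ (inj₂ y≡c)  = inj₂ y≡c
    ... | inj₁ refl        | inj₁ refl        = contradiction x~y (~-irrefl refl)
    ... | inj₁ refl        | inj₂ (inj₁ refl) = contradiction x~y a≁b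
    ... | inj₂ (inj₁ refl) | inj₁ refl        = contradiction (~-sym x~y) a≁b
    ... | inj₂ (inj₁ refl) | inj₂ (inj₁ refl) = contradiction x~y (~-irrefl refl)

  -- Following one chosen neighbour of each vertex shows some vertex adjacent to both others. This
  -- handles labels too small to have a split.
  three-vertices-degenerate : ∀ {a b c} → 3 ≤ k → (∀ x → x ≡ a ⊎ x ≡ b ⊎ x ≡ c) →
    (∀ x → ∃ λ y → x ~ y) → IsDegenerate K
  three-vertices-degenerate {a} {b} {c} 3≤k cover adjacent
    with adjacent a | adjacent b | adjacent c
  ... | x , a~x | y , b~y | z , c~z with cover x | cover y | cover z
  ... | inj₁ refl | _ | _ = contradiction a~x (~-irrefl refl)
  ... | _ | inj₂ (inj₁ refl) | _ = contradiction b~y (~-irrefl refl)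
  ... | _ | _ | inj₂ (inj₂ refl) = contradiction c~z (~-irrefl refl)
  ... | inj₂ (inj₁ refl) | _ | inj₁ refl =
    covered-degenerate 3≤k (λ x → Sum.[ inj₂ ∘ inj₂ , Sum.map₂ inj₁ ] (cover x)) a~x (~-sym c~z)
  ... | inj₂ (inj₁ refl) | _ | inj₂ (inj₁ refl) =
    covered-degenerate 3≤k (λ x → Sum.map₂ Sum.swap (cover x)) (~-sym a~x) (~-sym c~z)
  ... | inj₂ (inj₂ refl) | inj₁ refl | _ =
    covered-degenerate 3≤k (λ x → Sum.[ inj₂ ∘ inj₂ , Sum.map₂ inj₁ ] (cover x)) (~-sym b~y) a~x
  ... | inj₂ (inj₂ refl) | inj₂ (inj₂ refl) | _ =
    covered-degenerate 3≤k cover (~-sym a~x) (~-sym b~y)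

-- Full and Void stand for the perfect and the empty markers of a node labelled K, and
-- FullInward q and VoidInward q for the opposite of q being perfect and empty.
module Inward {k : ℕ} (K : Graph (Fin k)) (Full Void : Fin k → Set)
  (full⊎void : ∀ x → Full x ⊎ Void x) (full-not-void : ∀ {x} → Full x → ¬ Void x)
  (not-all-void : ¬ (∀ x → Void x)) where
  open Graph K

  FullInward VoidInward Inward : Fin k → Set
  FullInward q = ∀ {x} → x ≢ q → (q ~ x → Full x) × (¬ q ~ x → Void x)
  VoidInward q = ∀ {x} → x ≢ q → Void x
  Inward q     = FullInward q ⊎ VoidInward q

  void-inward-unique : ∀ {q r} → q ≢ r → VoidInward q → ¬ VoidInward r
  void-inward-unique {q} q≢r vq vr = not-all-void void
    where
    void : ∀ x → Void x
    void x with x Finₚ.≟ q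
    ... | yes refl = vr q≢r
    ... | no x≢q   = vq x≢q

  full-adjacent : ∀ {q x} → FullInward q → x ≢ q → Full x → q ~ x
  full-adjacent {q} {x} fq x≢q f with ~-dec q x
  ... | yes q~x = q~x
  ... | no q≁x  = contradiction (proj₂ (fq x≢q) q≁x) (full-not-void f)

  module _ {q r : Fin k} (q≢r : q ≢ r) where
    -- The only case of `pair-split` that needs the states. For two full inward markers the
    -- neighbours outside the pair are exactly the full markers there; if one is void inward,
    -- nothing outside is full and the other has no neighbour there.
    transfer : Inward q → Inward r → ∀ {x y} → x ≢ q → x ≢ r → y ≢ q → y ≢ r →
      q ~ x → r ~ y → q ~ y
    transfer (inj₁ fq) (inj₁ fr) _ _ y≢q y≢r _ r~y = full-adjacent fq y≢q (proj₁ (fr y≢r) r~y)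
    transfer (inj₁ fq) (inj₂ vr) x≢q x≢r _ _ q~x _ =
      contradiction (vr x≢r) (full-not-void (proj₁ (fq x≢q) q~x))
    transfer (inj₂ vq) (inj₁ fr) _ _ y≢q y≢r _ r~y =
      contradiction (vq y≢q) (full-not-void (proj₁ (fr y≢r) r~y))
    transfer (inj₂ vq) (inj₂ vr) _ _ _ _ _ _ = ⊥-elim (void-inward-unique q≢r vq vr)

    pair : Subset k
    pair = ⁅ q ⁆ ∪ ⁅ r ⁆

    q∈pair : q ∈ pair
    q∈pair = x∈p∪q⁺ (inj₁ (x∈⁅x⁆ q))

    r∈pair : r ∈ pair
    r∈pair = x∈p∪q⁺ (inj₂ (x∈⁅x⁆ r))

    ∈pair : ∀ {x} → x ∈ pair → x ≡ q ⊎ x ≡ r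
    ∈pair x∈ = Sum.map (x∈⁅y⁆⇒x≡y q) (x∈⁅y⁆⇒x≡y r) (x∈p∪q⁻ ⁅ q ⁆ ⁅ r ⁆ x∈)

    outside-pair : ∀ {x} → x ≢ q → x ≢ r → x ∈ ∁ pair
    outside-pair x≢q x≢r = x∉p⇒x∈∁p (Sum.[ x≢q , x≢r ] ∘ ∈pair)

  ∉pair : ∀ {q r} (q≢r : q ≢ r) {x} → x ∉ pair q≢r → x ≢ q × x ≢ r
  ∉pair q≢r x∉ = (λ { refl → x∉ (q∈pair q≢r) }) , λ { refl → x∉ (r∈pair q≢r) }

  -- Full inward markers are twins; a void one is the only neighbour of a full one.
  pair-split : ∀ {q r z w} (q≢r : q ≢ r) → Inward q → Inward r →
    z ≢ q → z ≢ r → w ≢ q → w ≢ r → w ≢ z → IsSplit K (pair q≢r)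
  pair-split {q} {r} q≢r iq ir z≢q z≢r w≢q w≢r w≢z =
    distinct⇒1<∣∣ q≢r (q∈pair q≢r) (r∈pair q≢r) ,
    distinct⇒1<∣∣ w≢z (outside-pair q≢r w≢q w≢r) (outside-pair q≢r z≢q z≢r) ,
    joined
    where
    joined : ∀ {x y} → Neighbourhood K (∁ (pair q≢r)) x → Neighbourhood K (pair q≢r) y → x ~ y
    joined (x∉ , y′ , y′∈ , y′~x) (y∉ , x′ , x′∈ , x′~y)
      with ∈pair q≢r (x∉∁p⇒x∈p x∉) | ∈pair q≢r x′∈
         | ∉pair q≢r y∉ | ∉pair q≢r (x∈∁p⇒x∉p y′∈)
    ... | inj₁ refl | inj₁ refl | _ | _ = x′~y
    ... | inj₂ refl | inj₂ refl | _ | _ = x′~y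
    ... | inj₁ refl | inj₂ refl | y≢q , y≢r | y′≢q , y′≢r =
      transfer q≢r iq ir y′≢q y′≢r y≢q y≢r (~-sym y′~x) x′~y
    ... | inj₂ refl | inj₁ refl | y≢q , y≢r | y′≢q , y′≢r =
      transfer (q≢r ∘ sym) ir iq y′≢r y′≢q y≢r y≢q (~-sym y′~x) x′~y

  -- With a fourth marker the pair is one side of a split; with only three markers the label is
  -- degenerate.
  inward-pair-not-prime : ∀ {q r} → 3 ≤ k → q ≢ r → Inward q → Inward r → ¬ IsPrime K
  inward-pair-not-prime {q} {r} 3≤k q≢r iq ir prime@(_ , no-split , not-degenerate)
    with z , z≢q , z≢r ← third 3≤k q r
    with any? (λ w → ¬? (w Finₚ.≟ q) ×-dec ¬? (w Finₚ.≟ r) ×-dec ¬? (w Finₚ.≟ z))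
  ... | yes (w , w≢q , w≢r , w≢z) =
    no-split (pair q≢r) (pair-split q≢r iq ir z≢q z≢r w≢q w≢r w≢z)
  ... | no none = not-degenerate (three-vertices-degenerate K 3≤k cover (neighbour K 3≤k (inj₁ prime)))
    where
    cover : ∀ x → x ≡ q ⊎ x ≡ r ⊎ x ≡ z
    cover x with x Finₚ.≟ q | x Finₚ.≟ r | x Finₚ.≟ z
    ... | yes e | _ | _ = inj₁ e
    ... | _ | yes e | _ = inj₂ (inj₁ e)
    ... | _ | _ | yes e = inj₂ (inj₂ e)
    ... | no x≢q | no x≢r | no x≢z = contradiction (x , x≢q , x≢r , x≢z) none

  FullClique FullCentreStar : Set
  FullClique     = IsClique K × (∀ x → Full x)
  FullCentreStar = ∃ λ c → IsStarWithCentre K c × Full c × (∀ {x} → x ≢ c → Void x)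

  off-one : ∀ {q r : Fin k} → q ≢ r → ∀ x → x ≢ q ⊎ x ≢ r
  off-one {q} q≢r x with x Finₚ.≟ q
  ... | yes refl = inj₂ q≢r
  ... | no x≢q   = inj₁ x≢q

  void-full-clique : ∀ {q r} → 3 ≤ k → VoidInward q → FullInward r → ¬ IsClique K
  void-full-clique {q} {r} 3≤k vq fr clique with z , z≢q , z≢r ← third 3≤k q r =
    full-not-void (proj₁ (fr z≢r) (clique (z≢r ∘ sym))) (vq z≢q)

  inward-pair-clique : ∀ {q r} → 3 ≤ k → q ≢ r → Inward q → Inward r → IsClique K → ∀ x → Full x
  inward-pair-clique 3≤k q≢r (inj₁ fq) (inj₁ fr) clique x with off-one q≢r x
  ... | inj₁ x≢q = proj₁ (fq x≢q) (clique (x≢q ∘ sym))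
  ... | inj₂ x≢r = proj₁ (fr x≢r) (clique (x≢r ∘ sym))
  inward-pair-clique 3≤k q≢r (inj₂ vq) (inj₁ fr) clique = ⊥-elim (void-full-clique 3≤k vq fr clique)
  inward-pair-clique 3≤k q≢r (inj₁ fq) (inj₂ vr) clique = ⊥-elim (void-full-clique 3≤k vr fq clique)
  inward-pair-clique 3≤k q≢r (inj₂ vq) (inj₂ vr) clique = ⊥-elim (void-inward-unique q≢r vq vr)

  module _ {c : Fin k} (star : IsStarWithCentre K c) where
    private
      3≤k = proj₁ star
      spoke = proj₁ (proj₂ star)
      at-centre = proj₂ (proj₂ star)

    Centred : Set
    Centred = Full c × (∀ {x} → x ≢ c → Void x)

    -- If `q` were the centre, a third marker would be full and hence adjacent to `r`, an edge
    -- avoiding the centre.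
    not-centre : ∀ {q r} → q ≢ r → FullInward q → FullInward r → q ≢ c
    not-centre {r = r} q≢r fq fr refl with z , z≢c , z≢r ← third 3≤k c r
      with at-centre (full-adjacent fr z≢r (proj₁ (fq z≢c) (spoke z≢c)))
    ... | inj₁ r≡c = q≢r (sym r≡c)
    ... | inj₂ z≡c = z≢c z≡c

    full-inward-pair-star : ∀ {q r} → q ≢ r → FullInward q → FullInward r → Centred
    full-inward-pair-star {q} {r} q≢r fq fr = proj₁ (fq (q≢c ∘ sym)) (~-sym (spoke q≢c)) , void
      where
      q≢c = not-centre q≢r fq fr
      r≢c = not-centre (q≢r ∘ sym) fr fq

      void : ∀ {x} → x ≢ c → Void x
      void {x} x≢c with off-one q≢r x
      ... | inj₁ x≢q = proj₂ (fq x≢q) (Sum.[ q≢c , x≢c ] ∘ at-centre)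
      ... | inj₂ x≢r = proj₂ (fr x≢r) (Sum.[ r≢c , x≢c ] ∘ at-centre)

    -- Some marker is full, so `q` is, and it is adjacent to `r`. One of the two is therefore the
    -- centre; were it `r`, a third marker would be both full and void.
    void-full-inward-star : ∀ {q r} → q ≢ r → VoidInward q → FullInward r → Centred
    void-full-inward-star {q} {r} q≢r vq fr with full⊎void q
    ... | inj₂ v = ⊥-elim (not-all-void void)
      where
      void : ∀ x → Void x
      void x with x Finₚ.≟ q
      ... | yes refl = v
      ... | no x≢q   = vq x≢q
    ... | inj₁ full with at-centre (full-adjacent fr q≢r full)
    ...   | inj₂ refl = full , vq
    ...   | inj₁ refl with z , z≢q , z≢r ← third 3≤k q r =
      contradiction (vq z≢q) (full-not-void (proj₁ (fr z≢r) (spoke z≢r)))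

    inward-pair-star : ∀ {q r} → q ≢ r → Inward q → Inward r → Centred
    inward-pair-star q≢r (inj₁ fq) (inj₁ fr) = full-inward-pair-star q≢r fq fr
    inward-pair-star q≢r (inj₂ vq) (inj₁ fr) = void-full-inward-star q≢r vq fr
    inward-pair-star q≢r (inj₁ fq) (inj₂ vr) = void-full-inward-star (q≢r ∘ sym) vr fq
    inward-pair-star q≢r (inj₂ vq) (inj₂ vr) = ⊥-elim (void-inward-unique q≢r vq vr)

  inward-pair : ∀ {q r} → 3 ≤ k → IsPrime K ⊎ IsDegenerate K → q ≢ r → Inward q → Inward r →
    FullClique ⊎ FullCentreStar
  inward-pair 3≤k (inj₁ prime) q≢r iq ir = contradiction prime (inward-pair-not-prime 3≤k q≢r iq ir)
  inward-pair 3≤k (inj₂ (inj₁ clique)) q≢r iq ir =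
    inj₁ ((λ {x} {y} → clique {x} {y}) , inward-pair-clique 3≤k q≢r iq ir clique)
  inward-pair 3≤k (inj₂ (inj₂ (c , star))) q≢r iq ir = inj₂ (c , star , inward-pair-star star q≢r iq ir)

-- Accessibility and the states of leaves and markers.

module States {n p : ℕ} (G : Graph (Fin n)) (𝒯 : GLT n p) (split : IsSplitTreeOf 𝒯 G) (S : Subset n) where
  open GLT 𝒯
  open Accessibility 𝒯
  open Branches 𝒯
  open Marked G 𝒯 S
  open _▹_

  module Label (u : Fin p) = Graph (label u) using ()
    renaming (_~_ to infix 4 _∼_; ~-dec to ∼-dec; ~-sym to ∼-sym; ~-irrefl to ∼-irrefl)

  label-kind : ∀ u → IsPrime (label u) ⊎ IsDegenerate (label u)
  label-kind = proj₁ (proj₁ split)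

  leaf-end : ∀ {e f ℓ} → tgt e ≡ leaf ℓ → ¬ e ▹ f
  leaf-end {e} {f} {ℓ} refl (refl , t≢s) = t≢s (trans (sym (unique (src~tgt f))) (unique (~-sym (src~tgt e))))
    where
    unique : ∀ {y} → leaf ℓ ~ y → proj₁ (leaf-deg ℓ) ≡ y
    unique = proj₂ (proj₂ (leaf-deg ℓ))

  tgt-leaf : ∀ a {ℓ} → opposite a ≡ leaf ℓ → tgt (edgeOf a) ≡ leaf ℓ
  tgt-leaf a = extremity-leaf (reverse (edgeOf a))

  L⇒beyond : ∀ a {x} → L a x → Beyond (edgeOf a) (leaf x)
  L⇒beyond (leaf ℓ) {x} x≢ℓ with beyond-total (edgeOf (leaf ℓ)) (leaf x)
  ... | inj₁ b                = b
  ... | inj₂ (_ , ε , refl)   = contradiction refl x≢ℓ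
  ... | inj₂ (_ , d ◅ _ , _)  = ⊥-elim (leaf-end refl d)
  L⇒beyond (marker u q) {x} l with beyond-total (edgeOf (marker u q)) (leaf x)
  ... | inj₁ b = b
  ... | inj₂ b = contradiction (beyond⇒walk b) l

  beyond⇒L : ∀ a {x} → Beyond (edgeOf a) (leaf x) → L a x
  beyond⇒L (leaf ℓ) (f , c , t) refl = no-return c (sym t)
  beyond⇒L (marker u q) b w          = beyond-disjoint b (walk⇒beyond w)

  -- An alternating sequence whose first step, across the tree-edge of `a`, is already made. It
  -- cannot turn back, so membership in `L a` is automatic and `Reaches a` agrees with `A a`.
  Reaches : Element → Fin n → Set
  Reaches a x = Alternating label-step (opposite a) (leaf x)

  -- A label-edge joins distinct markers, so the tree-edges crossed by an alternating sequence form
  -- a chain.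
  reaches⇒beyond : ∀ a {x} → Reaches a x → Beyond (edgeOf a) (leaf x)
  reaches⇒beyond a = go a refl
    where
    go : ∀ a {o x} → opposite a ≡ o → Alternating label-step o (leaf x) → Beyond (edgeOf a) (leaf x)
    go a eq [] = edgeOf a , ε , tgt-leaf a eq
    go a eq (via-label (labelEdge {u} {r} {q} r∼q) (via-tree alt)) = beyond-▹
      (subst (_▹ edgeOf (marker u q))
        (trans (cong (reverse ∘ edgeOf) (sym eq)) (trans (cong reverse (edgeOf-opposite a)) (reverse-involutive _)))
        (▹-markers λ { refl → Label.∼-irrefl u refl r∼q }))
      (go (marker u q) refl alt)

  reaches-marker : ∀ {u r q x} → Label._∼_ u r q → Reaches (marker u q) x → Reaches (opposite (marker u r)) x
  reaches-marker {u} {r} r∼q alt =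
    subst (λ o → Alternating label-step o (leaf _)) (sym (opposite-involutive (marker u r)))
      (via-label (labelEdge r∼q) (via-tree alt))

  reaches-marker⁻¹ : ∀ {u r x} → Reaches (opposite (marker u r)) x →
    ∃ λ q → Label._∼_ u r q × Reaches (marker u q) x
  reaches-marker⁻¹ {u} {r} alt = go (opposite-involutive (marker u r)) alt
    where
    go : ∀ {o x} → o ≡ marker u r → Alternating label-step o (leaf x) →
      ∃ λ q → Label._∼_ u r q × Reaches (marker u q) x
    go refl (via-label (labelEdge r∼q) (via-tree alt)) = _ , r∼q , alt

  A⇒reaches : ∀ a {x} → A a x → Reaches a x
  A⇒reaches (leaf ℓ) a with Equivalence.to (proj₂ split _ _) a
  ... | ℓ≢x , _ , []             = contradiction refl ℓ≢x
  ... | ℓ≢x , _ , via-tree alt   = alt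
  ... | ℓ≢x , _ , via-label () _
  A⇒reaches (marker u q) (l , _ , via-tree alt) = alt
  -- A sequence starting inside the label leaves `u` by another marker and ends outside
  -- `L (marker u q)`.
  A⇒reaches (marker u q) (l , _ , via-label (labelEdge {r = r} q∼r) (via-tree alt)) =
    ⊥-elim (beyond-disjoint (L⇒beyond (marker u q) l)
      (beyond-▹ (▹-markers λ { refl → Label.∼-irrefl u refl q∼r }) (reaches⇒beyond (marker u r) alt)))

  reaches⇒A : ∀ a {x} → Reaches a x → A a x
  reaches⇒A (leaf ℓ) r =
    Equivalence.from (proj₂ split _ _) (beyond⇒L (leaf ℓ) (reaches⇒beyond (leaf ℓ) r) ∘ sym , _ , via-tree r)
  reaches⇒A (marker u q) r = beyond⇒L (marker u q) (reaches⇒beyond (marker u q) r) , _ , via-tree r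

  perfect-intro : ∀ a → (∀ {x} → x ∈ S → Beyond (edgeOf a) (leaf x) → Reaches a x) →
    (∀ {x} → Reaches a x → x ∈ S) → IsPerfect a
  perfect-intro a to from =
    (λ (x∈S , l) → reaches⇒A a (to x∈S (L⇒beyond a l))) ,
    λ x∈A → from (A⇒reaches a x∈A) , beyond⇒L a (reaches⇒beyond a (A⇒reaches a x∈A))

  perfect-reaches : ∀ a {x} → IsPerfect a → x ∈ S → Beyond (edgeOf a) (leaf x) → Reaches a x
  perfect-reaches a (to , _) x∈S b = A⇒reaches a (to (x∈S , beyond⇒L a b))

  reaches-marked : ∀ a {x} → IsPerfect a → Reaches a x → x ∈ S
  reaches-marked a (_ , from) r = proj₁ (from (reaches⇒A a r))

  empty-intro : ∀ a → (∀ {x} → Beyond (edgeOf a) (leaf x) → x ∉ S) → IsEmpty a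
  empty-intro a out x (x∈S , l) = out (L⇒beyond a l) x∈S

  empty-unmarked : ∀ a {x} → IsEmpty a → Beyond (edgeOf a) (leaf x) → x ∉ S
  empty-unmarked a e b x∈S = e _ (x∈S , beyond⇒L a b)

  -- No label has an isolated vertex, so a sequence can be continued until it meets a leaf. Hence
  -- `A a` is never empty, and perfect and empty exclude each other.
  reaches-some : ∀ a → ∃ (Reaches a)
  reaches-some a = go a (◂-wellFounded (edgeOf a))
    where
    go : ∀ a → Acc _◂_ (edgeOf a) → ∃ (Reaches a)
    go a (acc rec) with facing a
    ... | inj₁ (ℓ , eq) = ℓ , subst (λ o → Alternating label-step o (leaf ℓ)) (sym eq) []
    ... | inj₂ (u , r , refl) with q , r∼q ← neighbour (label u) (deg≥3 u) (label-kind u) r =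
      Product.map₂ (reaches-marker r∼q) (go (marker u q) (rec (subst (_▹ edgeOf (marker u q))
        (sym (edgeOf-opposite (marker u r))) (▹-markers λ { refl → Label.∼-irrefl u refl r∼q }))))

  perfect-not-empty : ∀ a → IsPerfect a → ¬ IsEmpty a
  perfect-not-empty a pf em with x , r ← reaches-some a =
    empty-unmarked a em (reaches⇒beyond a r) (reaches-marked a pf r)

  Pure : Element → Set
  Pure a = IsPerfect a ⊎ IsEmpty a

  -- Only `ℓ` lies beyond `a`, and it is reached; its membership in `S` decides the state.
  facing-leaf-pure : ∀ a {ℓ} → opposite a ≡ leaf ℓ → Pure a
  facing-leaf-pure a {ℓ} eq = Sum.map perfect empty (toSum (ℓ ∈? S))
    where
    only : ∀ {x} → Beyond (edgeOf a) (leaf x) → x ≡ ℓ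
    only (_ , ε , t)     = leaf-injective (trans (sym t) (tgt-leaf a eq))
    only (_ , d ◅ _ , _) = ⊥-elim (leaf-end (tgt-leaf a eq) d)

    perfect : ℓ ∈ S → IsPerfect a
    perfect ℓ∈S = perfect-intro a
      (λ _ b → subst (λ o → Alternating label-step o _) (trans (cong leaf (only b)) (sym eq)) [])
      (λ r → subst (_∈ S) (sym (only (reaches⇒beyond a r))) ℓ∈S)

    empty : ℓ ∉ S → IsEmpty a
    empty ℓ∉S = empty-intro a λ b x∈S → ℓ∉S (subst (_∈ S) (only b) x∈S)

  -- How the states at a node determine the states facing it.

  module Node (u : Fin p) where
    open Label u

    beyond-marker : ∀ {q r x} → q ≢ r → Beyond (edgeOf (marker u q)) x →
      Beyond (edgeOf (opposite (marker u r))) x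
    beyond-marker {q} {r} {x} q≢r b =
      subst (λ e → Beyond e x) (sym (edgeOf-opposite (marker u r))) (beyond-▹ (▹-markers q≢r) b)

    beyond-marker⁻¹ : ∀ {r ℓ} → Beyond (edgeOf (opposite (marker u r))) (leaf ℓ) →
      ∃ λ q → q ≢ r × Beyond (edgeOf (marker u q)) (leaf ℓ)
    beyond-marker⁻¹ {r} {ℓ} b = go (subst (λ e → Beyond e (leaf ℓ)) (edgeOf-opposite (marker u r)) b)
      where
      go : Beyond (reverse (edgeOf (marker u r))) (leaf ℓ) →
        ∃ λ q → q ≢ r × Beyond (edgeOf (marker u q)) (leaf ℓ)
      go (f , d ◅ c , t) with q , q≢r , refl ← ▹-marker⁻¹ d = q , q≢r , f , c , t

    same-marker : ∀ {q q′ r x} → q ≢ r → q′ ≢ r → Beyond (edgeOf (marker u q)) x →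
      Beyond (edgeOf (marker u q′)) x → q ≡ q′
    same-marker {q} {q′} q≢r q′≢r b b′ = marker-injective (begin
      marker u q                       ≡⟨ extremity-edgeOf _ ⟨
      extremity (edgeOf (marker u q))  ≡⟨ cong extremity siblings ⟩
      extremity (edgeOf (marker u q′)) ≡⟨ extremity-edgeOf _ ⟩
      marker u q′                      ∎)
      where
      open ≡-Reasoning
      siblings = beyond-siblings (▹-markers q≢r) (▹-markers q′≢r) b b′

    ∼⇒≢ : ∀ {q r} → r ∼ q → q ≢ r
    ∼⇒≢ r∼q refl = ∼-irrefl refl r∼q

    -- The sequence leaves `u` by a marker beyond which `x` lies, and the branches at `u` are
    -- disjoint.
    reaches-through : ∀ {q r x} → q ≢ r → Beyond (edgeOf (marker u q)) (leaf x) →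
      Reaches (opposite (marker u r)) x → r ∼ q × Reaches (marker u q) x
    reaches-through q≢r b alt with q′ , r∼q′ , alt′ ← reaches-marker⁻¹ alt
      with refl ← same-marker q≢r (∼⇒≢ r∼q′) b (reaches⇒beyond (marker u q′) alt′) = r∼q′ , alt′

    -- The predicates of `Inward` at `u`, available here before every marker of `u` is known to be
    -- perfect or empty.
    FullInward VoidInward : Fin (deg u) → Set
    FullInward r = ∀ {q} → q ≢ r → (r ∼ q → IsPerfect (marker u q)) × (¬ r ∼ q → IsEmpty (marker u q))
    VoidInward r = ∀ {q} → q ≢ r → IsEmpty (marker u q)

    perfect⇒inward : ∀ {r} → IsPerfect (opposite (marker u r)) → FullInward r
    perfect⇒inward {r} pf {q} q≢r =
      (λ r∼q → perfect-intro (marker u q)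
        (λ x∈S b → proj₂ (through x∈S b))
        (λ alt → reaches-marked (opposite (marker u r)) pf (reaches-marker r∼q alt))) ,
      (λ r≁q → empty-intro (marker u q) λ b x∈S → r≁q (proj₁ (through x∈S b)))
      where
      through : ∀ {x} → x ∈ S → Beyond (edgeOf (marker u q)) (leaf x) → r ∼ q × Reaches (marker u q) x
      through x∈S b =
        reaches-through q≢r b (perfect-reaches (opposite (marker u r)) pf x∈S (beyond-marker q≢r b))

    inward⇒perfect : ∀ {r} → FullInward r → IsPerfect (opposite (marker u r))
    inward⇒perfect {r} full = perfect-intro (opposite (marker u r)) to from
      where
      to : ∀ {x} → x ∈ S → Beyond (edgeOf (opposite (marker u r))) (leaf x) → Reaches (opposite (marker u r)) x
      to x∈S b with q , q≢r , b′ ← beyond-marker⁻¹ b with ∼-dec r q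
      ... | yes r∼q = reaches-marker r∼q (perfect-reaches (marker u q) (proj₁ (full q≢r) r∼q) x∈S b′)
      ... | no r≁q  = contradiction x∈S (empty-unmarked (marker u q) (proj₂ (full q≢r) r≁q) b′)

      from : ∀ {x} → Reaches (opposite (marker u r)) x → x ∈ S
      from alt with q , r∼q , alt′ ← reaches-marker⁻¹ alt =
        reaches-marked (marker u q) (proj₁ (full (∼⇒≢ r∼q)) r∼q) alt′

    empty⇒inward : ∀ {r} → IsEmpty (opposite (marker u r)) → VoidInward r
    empty⇒inward {r} em {q} q≢r =
      empty-intro (marker u q) λ b → empty-unmarked (opposite (marker u r)) em (beyond-marker q≢r b)

    inward⇒empty : ∀ {r} → VoidInward r → IsEmpty (opposite (marker u r))
    inward⇒empty {r} void = empty-intro (opposite (marker u r)) out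
      where
      out : ∀ {x} → Beyond (edgeOf (opposite (marker u r))) (leaf x) → x ∉ S
      out b with q , q≢r , b′ ← beyond-marker⁻¹ b = empty-unmarked (marker u q) (void q≢r) b′

    pure-marker : ∀ {q r} → q ≢ r → Pure (opposite (marker u r)) → Pure (marker u q)
    pure-marker {q} {r} q≢r (inj₂ em) = inj₂ (empty⇒inward em q≢r)
    pure-marker {q} {r} q≢r (inj₁ pf) with ∼-dec r q
    ... | yes r∼q = inj₁ (proj₁ (perfect⇒inward pf q≢r) r∼q)
    ... | no r≁q  = inj₂ (proj₂ (perfect⇒inward pf q≢r) r≁q)

  open Node

  -- Deciding the states.

  abstract
    -- The states of `opposite (marker u r)` are determined by those of the other markers of `u`,
    -- whose tree-edges lie further out; the recursion ends at the leaves.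
    states? : ∀ a → Dec (IsPerfect a) × Dec (IsEmpty a)
    states? a = go a (◂-wellFounded (edgeOf a))
      where
      go : ∀ a → Acc _◂_ (edgeOf a) → Dec (IsPerfect a) × Dec (IsEmpty a)
      go a (acc rec) with facing a
      ... | inj₁ (_ , eq) with facing-leaf-pure a eq
      ...   | inj₁ pf = yes pf , no (perfect-not-empty a pf)
      ...   | inj₂ em = no (λ pf → perfect-not-empty a pf em) , yes em
      go _ (acc rec) | inj₂ (u , r , refl) =
        map′ (λ full → inward⇒perfect u (λ {q} → full q)) (λ pf q → perfect⇒inward u pf)
          (all? λ q → decide q λ q≢r →
            (Label.∼-dec u r q →-dec proj₁ (ih q≢r)) ×-dec (¬? (Label.∼-dec u r q) →-dec proj₂ (ih q≢r))) ,
        map′ (λ void → inward⇒empty u (λ {q} → void q)) (λ em q → empty⇒inward u em)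
          (all? λ q → decide q (proj₂ ∘ ih))
        where
        ih : ∀ {q} → q ≢ r → Dec (IsPerfect (marker u q)) × Dec (IsEmpty (marker u q))
        ih {q} q≢r = go (marker u q)
          (rec (subst (_▹ edgeOf (marker u q)) (sym (edgeOf-opposite (marker u r))) (▹-markers q≢r)))

        -- The recursive results exist only for `q ≢ r`, since the tree-edge of `r` leads back.
        decide : ∀ {Q : Set} q → (q ≢ r → Dec Q) → Dec (q ≢ r → Q)
        decide q Q? with q Finₚ.≟ r
        ... | yes q≡r = yes (contradiction q≡r)
        ... | no q≢r  = map′ (λ x _ → x) (λ f → f q≢r) (Q? q≢r)

  pure? : ∀ a → Dec (Pure a)
  pure? a = proj₁ (states? a) ⊎-dec proj₂ (states? a)

  impure⇒mixed : ∀ {a} → ¬ Pure a → IsMixed a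
  impure⇒mixed impure = impure ∘ inj₁ , impure ∘ inj₂

  mixed⇒impure : ∀ {a} → IsMixed a → ¬ Pure a
  mixed⇒impure (¬pf , _) (inj₁ pf) = ¬pf pf
  mixed⇒impure (_ , ¬em) (inj₂ em) = ¬em em

-- Tree-edges pure at both extremities, and the nodes of cases 1 and 2.

module Classification {n p : ℕ} (G : Graph (Fin n)) (𝒯 : GLT n p) (split : IsSplitTreeOf 𝒯 G)
  (S : Subset n) (nonempty : Nonempty S) where
  open GLT 𝒯
  open Accessibility 𝒯
  open Branches 𝒯
  open Marked G 𝒯 S
  open Subgraphs tree
  open States G 𝒯 split S
  open _▹_

  two-markers : ∀ u → ∃₂ λ (q r : Fin (deg u)) → q ≢ r
  two-markers u with deg u | deg≥3 u
  ... | _ | s≤s (s≤s _) = 0F , 1F , λ ()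

  ▹-markers⁻¹ : ∀ {e f} → e ▹ f → ∃ λ u → ∃₂ λ q r → q ≢ r ×
    e ≡ reverse (edgeOf (marker u r)) × f ≡ edgeOf (marker u q)
  ▹-markers⁻¹ {e} {f} d with src f in s
  ... | leaf _ = ⊥-elim (leaf-end (trans (tgt≡src d) s) d)
  ... | node u with r , re≡ ← at-node (reverse e) (trans (tgt≡src d) s)
    with refl ← trans (sym (reverse-involutive e)) (cong reverse re≡)
    with q , q≢r , f≡ ← ▹-marker⁻¹ d = u , q , r , q≢r , refl , f≡

  Pureᴱ : TreeEdge → Set
  Pureᴱ e = Pure (extremity e)

  BothPure : TreeEdge → Set
  BothPure e = Pureᴱ e × Pureᴱ (reverse e)

  bothPure? : ∀ e → Dec (BothPure e)
  bothPure? e = pure? (extremity e) ×-dec pure? (extremity (reverse e))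

  pure-reverse² : ∀ {e} → Pureᴱ e → Pureᴱ (reverse (reverse e))
  pure-reverse² {e} = subst Pureᴱ (sym (reverse-involutive e))

  bothPure-reverse : ∀ {e} → BothPure e → BothPure (reverse e)
  bothPure-reverse (pe , pr) = pr , pure-reverse² pe

  pure-▹ : ∀ {e f} → e ▹ f → Pureᴱ e → Pureᴱ f
  pure-▹ d pe with u , q , r , q≢r , refl , refl ← ▹-markers⁻¹ d =
    subst Pure (sym (extremity-edgeOf (marker u q))) (Node.pure-marker u q≢r pe)

  pure-▹* : ∀ {e f} → e ▹* f → Pureᴱ e → Pureᴱ f
  pure-▹* ε       = λ pe → pe
  pure-▹* (d ◅ c) = pure-▹* c ∘ pure-▹ d

  -- Convexity: purity passes outwards from `e` along the chain, and from `reverse g` along the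
  -- reversed chain.
  bothPure-between : ∀ {e f g} → BothPure e → e ▹* f → f ▹* g → BothPure g → BothPure f
  bothPure-between (pe , _) c c′ (_ , pr) = pure-▹* c pe , pure-▹* (▹*-reverse c′) pr

  -- An element of `S` lies on one of the two sides of the tree-edge.
  not-both-empty : ∀ a → IsEmpty a → ¬ IsEmpty (opposite a)
  not-both-empty a em em′ with beyond-total (edgeOf a) (leaf (proj₁ nonempty))
  ... | inj₁ b = empty-unmarked a em b (proj₂ nonempty)
  ... | inj₂ b = empty-unmarked (opposite a) em′
    (subst (λ e → Beyond e _) (sym (edgeOf-opposite a)) b) (proj₂ nonempty)

  opposite-extremity : ∀ e → opposite (extremity e) ≡ extremity (reverse e)
  opposite-extremity e = cong (extremity ∘ reverse) (edgeOf-extremity e)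

  bothPure⇒PP⊎PE : ∀ {e} → BothPure e → PP e ⊎ PE e
  bothPure⇒PP⊎PE     (inj₁ pf , inj₁ pf′) = inj₁ (pf , pf′)
  bothPure⇒PP⊎PE     (inj₁ pf , inj₂ em)  = inj₂ (inj₁ (pf , em))
  bothPure⇒PP⊎PE     (inj₂ em , inj₁ pf)  = inj₂ (inj₂ (em , pf))
  bothPure⇒PP⊎PE {e} (inj₂ em , inj₂ em′) =
    ⊥-elim (not-both-empty (extremity e) em (subst IsEmpty (sym (opposite-extremity e)) em′))

  PP⇒bothPure : ∀ {e} → PP e → BothPure e
  PP⇒bothPure (pf , pf′) = inj₁ pf , inj₁ pf′

  PE⇒bothPure : ∀ {e} → PE e → BothPure e
  PE⇒bothPure (inj₁ (pf , em)) = inj₁ pf , inj₂ em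
  PE⇒bothPure (inj₂ (em , pf)) = inj₂ em , inj₁ pf

  PP⇒¬PE : ∀ {e} → PP e → ¬ PE e
  PP⇒¬PE {e} (_ , pf) (inj₁ (_ , em)) = perfect-not-empty (extremity (reverse e)) pf em
  PP⇒¬PE {e} (pf , _) (inj₂ (em , _)) = perfect-not-empty (extremity e) pf em

  Special : Fin p → Set
  Special u = PerfectClique u ⊎ PerfectCentreStar u

  -- Purity of the two extremities facing the common node makes `r` and `q` inward markers of its
  -- label, to which `inward-pair` applies.
  consecutive-bothPure : ∀ {e f} → e ▹ f → BothPure e → BothPure f → ∃ λ u → tgt e ≡ node u × Special u
  consecutive-bothPure d (pe , pre) (_ , prf)
    with u , q , r , q≢r , refl , refl ← ▹-markers⁻¹ d =
    u , refl , inward-pair (deg≥3 u) (label-kind u) (q≢r ∘ sym) (inward pe) (inward prf)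
    where
    -- The marker `r` is pure as the far extremity of `e`; the others inherit purity from `e`.
    pure : ∀ x → Pure (marker u x)
    pure x with x Finₚ.≟ r
    ... | yes refl = subst Pure (trans (cong extremity (reverse-involutive (edgeOf (marker u r))))
                                       (extremity-edgeOf (marker u r))) pre
    ... | no x≢r   = Node.pure-marker u x≢r pe

    not-all-empty : ¬ (∀ x → IsEmpty (marker u x))
    not-all-empty em = not-both-empty (marker u r) (em r) (Node.inward⇒empty u λ _ → em _)

    open Inward (label u) (IsPerfect ∘ marker u) (IsEmpty ∘ marker u) pure
      (λ {x} → perfect-not-empty (marker u x)) not-all-empty

    inward : ∀ {x} → Pure (opposite (marker u x)) → Inward x
    inward = Sum.map (λ pf → Node.perfect⇒inward u pf) (λ em → Node.empty⇒inward u em)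

  clique-opposite : ∀ {u} → PerfectClique u → ∀ q → IsPerfect (opposite (marker u q))
  clique-opposite {u} (clique , pf) q = Node.inward⇒perfect u
    λ x≢q → (λ _ → pf _) , λ q≁x → contradiction (clique (x≢q ∘ sym)) q≁x

  centre-opposite : ∀ {u} ((c , _) : PerfectCentreStar u) → IsEmpty (opposite (marker u c))
  centre-opposite {u} (_ , _ , _ , em) = Node.inward⇒empty u em

  off-centre-opposite : ∀ {u} ((c , _) : PerfectCentreStar u) → ∀ {q} → q ≢ c →
    IsPerfect (opposite (marker u q))
  off-centre-opposite {u} (c , (_ , spoke , at-centre) , pf , em) {q} q≢c =
    Node.inward⇒perfect u λ {x} x≢q → full x , λ q≁x → em λ { refl → q≁x (Label.∼-sym u (spoke q≢c)) }
    where
    full : ∀ x → Label._∼_ u q x → IsPerfect (marker u x)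
    full x q∼x with at-centre q∼x
    ... | inj₁ q≡c  = contradiction q≡c q≢c
    ... | inj₂ refl = pf

  -- `extremity (edgeOf a)` equals `a` only propositionally, whereas the extremity of the reversed
  -- tree-edge is `opposite a` by definition; so only the first argument is transported.
  at-marker : ∀ (Q : Element → Element → Set) {u q} → Q (marker u q) (opposite (marker u q)) →
    Q (extremity (edgeOf (marker u q))) (opposite (marker u q))
  at-marker Q {u} {q} = subst (λ a → Q a (opposite (marker u q))) (sym (extremity-edgeOf (marker u q)))

  clique⇒PP : ∀ {u} → PerfectClique u → ∀ q → PP (edgeOf (marker u q))
  clique⇒PP cl q = at-marker (λ a b → IsPerfect a × IsPerfect b) (proj₂ cl q , clique-opposite cl q)

  star⇒PE : ∀ {u} → PerfectCentreStar u → ∀ q → PE (edgeOf (marker u q))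
  star⇒PE {u} st@(c , _ , pf , em) q = at-marker PEᴹ (go q)
    where
    PEᴹ : Element → Element → Set
    PEᴹ a b = (IsPerfect a × IsEmpty b) ⊎ (IsEmpty a × IsPerfect b)

    go : ∀ q → PEᴹ (marker u q) (opposite (marker u q))
    go q with q Finₚ.≟ c
    ... | yes refl = inj₁ (pf , centre-opposite st)
    ... | no q≢c   = inj₂ (em q≢c , off-centre-opposite st q≢c)

  special-bothPure : ∀ {u e} → Special u → src e ≡ node u → BothPure e
  special-bothPure {e = e} sp s with q , refl ← at-node e s with sp
  ... | inj₁ cl = PP⇒bothPure (clique⇒PP cl q)
  ... | inj₂ st = PE⇒bothPure {edgeOf (marker _ q)} (star⇒PE st q)

  -- A common tree-edge would be PP because of the clique and PE because of the star.
  clique-star-apart : ∀ {u v q r} → opposite (marker u q) ≡ marker v r →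
    PerfectClique u → ¬ PerfectCentreStar v
  clique-star-apart {u} {v} {q} {r} opp cl st@(c , _ , _ , em) with r Finₚ.≟ c
  ... | yes refl = perfect-not-empty (marker u q) (proj₂ cl q)
    (subst IsEmpty (trans (cong opposite (sym opp)) (opposite-involutive (marker u q))) (centre-opposite st))
  ... | no r≢c = perfect-not-empty (marker v r) (subst IsPerfect opp (clique-opposite cl q)) (em r≢c)

  -- Two cliques admit a clique-join, and two stars joined at exactly one centre a star-join. In the
  -- remaining cases the states on the common tree-edge conflict.
  special-apart : ∀ {u v} → Special u → Special v → ¬ (node u ~ node v)
  special-apart {u} {v} su sv a = go su sv
    where
    e : TreeEdge
    e = edge (node u) (node v) a

    q = proj₁ (at-node e refl)
    r = proj₁ (at-node (reverse e) refl)

    opp-q : opposite (marker u q) ≡ marker v r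
    opp-q = opposite-extremity e

    opp-r : opposite (marker v r) ≡ marker u q
    opp-r = trans (cong opposite (sym opp-q)) (opposite-involutive (marker u q))

    star-star : PerfectCentreStar u → ¬ PerfectCentreStar v
    star-star su@(c , cu , _ , eu) sv@(d , dv , pv , ev) with q Finₚ.≟ c | r Finₚ.≟ d
    ... | yes q≡c  | no r≢d   = proj₂ (proj₂ (proj₁ split)) (u , v , a , c , d , cu , dv , inj₁ (q≡c , r≢d))
    ... | no q≢c   | yes r≡d  = proj₂ (proj₂ (proj₁ split)) (u , v , a , c , d , cu , dv , inj₂ (q≢c , r≡d))
    ... | yes refl | yes refl = perfect-not-empty (marker v r) pv (subst IsEmpty opp-q (centre-opposite su))
    ... | no q≢c   | no r≢d   =
      perfect-not-empty (marker v r) (subst IsPerfect opp-q (off-centre-opposite su q≢c)) (ev r≢d)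

    go : Special u → Special v → ⊥
    go (inj₁ cu) (inj₁ cv) = proj₁ (proj₂ (proj₁ split)) (u , v , a , proj₁ cu , proj₁ cv)
    go (inj₁ cu) (inj₂ sv) = clique-star-apart opp-q cu sv
    go (inj₂ su) (inj₁ cv) = clique-star-apart opp-r cv su
    go (inj₂ su) (inj₂ sv) = star-star su sv

  -- The remainder after all deletions.

  Kept : Vertex n p → Set
  Kept = Vtx remainder

  -- A discarded tree-edge takes its target along, so the remainder is the subgraph induced on the
  -- kept vertices.
  kept-edge : ∀ {x y} → Kept x → Kept y → x ~ y → Edg remainder x y
  kept-edge kx ky a = kx , ky , a , λ
    { e (inj₁ (_ , t)) → ky e t ; e (inj₂ (_ , t)) → kx e t }

  kept⇒⊑remainder : ∀ H → (∀ {x} → Vtx H x → Kept x) → H ⊑ remainder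
  kept⇒⊑remainder H kept = kept , λ h →
    kept-edge (kept (Edg⊆V H h)) (kept (Edg⊆V H (Edgsym H h))) (Edg⊆~ H h)

  discards-intro : ∀ {e} → Pureᴱ e → ¬ Pureᴱ (reverse e) → Discards e
  discards-intro pe ¬pr = pe , impure⇒mixed ¬pr

  -- If `reverse f` were pure, so would be `reverse e`, which continues it.
  discards-▹ : ∀ {e f} → e ▹ f → Discards e → Discards f
  discards-▹ d (pe , mr) = discards-intro (pure-▹ d pe) (mixed⇒impure mr ∘ pure-▹ (▹-reverse d))

  discards-▹* : ∀ {e f} → e ▹* f → Discards e → Discards f
  discards-▹* ε       = λ de → de
  discards-▹* (d ◅ c) = discards-▹* c ∘ discards-▹ d

  pure-kept-bothPure : ∀ {e} → Pureᴱ e → Kept (tgt e) → BothPure e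
  pure-kept-bothPure {e} pe kept = pe , decidable-stable (pure? _) λ ¬pr → kept e refl (discards-intro pe ¬pr)

  -- Any f ≢ e with the same target satisfies e ▹ reverse f.
  kept-unless-pure : ∀ {e} → ¬ Discards e → (∀ {f} → e ▹ reverse f → Discards f → ⊥) → Kept (tgt e)
  kept-unless-pure {e} ¬de none f t df with src f ≟ⱽ src e
  ... | yes s≡ = ¬de (subst Discards (edge-≡ s≡ t) df)
  ... | no s≢  = none (sym t , s≢) df

  bothPure-kept : ∀ {e} → BothPure e → Kept (tgt e)
  bothPure-kept {e} (pe , pr) = kept-unless-pure (λ (_ , m) → mixed⇒impure m pr)
    λ d (_ , m) → mixed⇒impure m (pure-▹ d pe)

  fully-mixed-kept : ∀ {e} → FullyMixed e → Kept (tgt e)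
  fully-mixed-kept {e} (m , m′) = kept-unless-pure (λ (pe , _) → mixed⇒impure m pe)
    λ {f} d (pf , _) → mixed⇒impure m′ (pure-▹ (▹-reverse d) (pure-reverse² pf))

  fully-mixed-reverse : ∀ {e} → FullyMixed e → FullyMixed (reverse e)
  fully-mixed-reverse {e} (m , m′) = m′ , subst (IsMixed ∘ extremity) (sym (reverse-involutive e)) m

  -- One orientation of `e` points away from `src f`. The chain leading to it starts with `f` or
  -- continues `reverse f`, and both are pure.
  bothPure-sees : ∀ {f} → BothPure f → ∀ e → Pureᴱ e ⊎ Pureᴱ (reverse e)
  bothPure-sees {f} (pf , pr) e with reach-edge (src f) e
  ... | g , s , c = Sum.map (λ c → pure-▹* c pg) (λ c → pure-▹* c pg) c
    where
    pg : Pureᴱ g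
    pg with tgt g ≟ⱽ tgt f
    ... | yes t≡ = subst Pureᴱ (edge-≡ (sym s) (sym t≡)) pf
    ... | no t≢  = pure-▹ (sym s , t≢) pr

  fully-mixed⇒¬bothPure : ∀ {e f} → FullyMixed e → ¬ BothPure f
  fully-mixed⇒¬bothPure {e} (m , m′) gf = Sum.[ mixed⇒impure m , mixed⇒impure m′ ] (bothPure-sees gf e)

  bothPure-chain : ∀ {e f g} → BothPure e → e ▹ f → f ▹* g → BothPure g → ∃ λ u → tgt e ≡ node u × Special u
  bothPure-chain ge d c gg = consecutive-bothPure d ge (bothPure-between ge (d ◅ ε) c gg)

  infix 4 _≈ᴱ?_
  _≈ᴱ?_ : ∀ e f → Dec (e ≈ᴱ f)
  e ≈ᴱ? f = (src e ≟ⱽ src f ×-dec tgt e ≟ⱽ tgt f) ⊎-dec (src e ≟ⱽ tgt f ×-dec tgt e ≟ⱽ src f)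

  -- A chain leads from `e` or `reverse e` to any other tree-edge pure at both extremities. By
  -- convexity its second tree-edge is pure at both extremities too, and the node in between is
  -- special.
  special-or-single : ∀ {e} → BothPure e → ∃ Special ⊎ (∀ {f} → BothPure f → e ≈ᴱ f)
  special-or-single {e} ge with any-edge? (λ f → bothPure? f ×-dec ¬? (e ≈ᴱ? f))
  ... | no none = inj₂ λ {f} gf → decidable-stable (e ≈ᴱ? f) λ e≉f → none (f , gf , e≉f)
  ... | yes (f , gf , e≉f) with reach-edge (src e) f
  ...   | g , s , c = inj₁ (Sum.[ special gf e≉f , special (bothPure-reverse gf) (e≉f ∘ Sum.swap) ] c)
    where
    special : ∀ {f} → BothPure f → ¬ e ≈ᴱ f → g ▹* f → ∃ Special
    special gf e≉f c with tgt g ≟ⱽ tgt e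
    ... | no t≢ = Product.map₂ proj₂ (bothPure-chain (bothPure-reverse ge) (sym s , t≢) c gf)
    ... | yes t≡ with refl ← edge-≡ {g} {e} s t≡ with c
    ...   | ε      = contradiction (inj₁ (refl , refl)) e≉f
    ...   | d ◅ c′ = Product.map₂ proj₂ (bothPure-chain ge d c′ gf)

  -- The last tree-edge on the way from `e` to a kept vertex is pure at both extremities, so it is
  -- `e` up to orientation.
  single-remainder : ∀ {e} → BothPure e → (∀ {f} → BothPure f → e ≈ᴱ f) → remainder ≈ edgeAlone e
  single-remainder {e} ge single =
    ((λ {x} → ends {x}) , edges) , kept⇒⊑remainder (edgeAlone e) kept
    where
    ends : ∀ {x} → Kept x → x ≡ src e ⊎ x ≡ tgt e
    ends {x} kx with beyond-total e x
    ... | inj₁ (f , c , refl) with single {f} (pure-kept-bothPure (pure-▹* c (proj₁ ge)) kx)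
    ...   | inj₁ (_ , t) = inj₂ (sym t)
    ...   | inj₂ (s , _) = inj₁ (sym s)
    ends {x} kx | inj₂ (f , c , refl) with single {f} (pure-kept-bothPure (pure-▹* c (proj₂ ge)) kx)
    ...   | inj₁ (_ , t) = inj₂ (sym t)
    ...   | inj₂ (s , _) = inj₁ (sym s)

    edges : ∀ {x y} → Edg remainder x y → HasEnds e x y
    edges {x} {y} (kx , ky , a , _) with ends kx | ends ky
    ... | inj₁ refl | inj₁ refl = contradiction a (~-irrefl refl)
    ... | inj₁ refl | inj₂ refl = inj₁ (refl , refl)
    ... | inj₂ refl | inj₁ refl = inj₂ (refl , refl)
    ... | inj₂ refl | inj₂ refl = contradiction a (~-irrefl refl)

    kept : ∀ {x} → x ≡ src e ⊎ x ≡ tgt e → Kept x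
    kept (inj₁ refl) = bothPure-kept (bothPure-reverse ge)
    kept (inj₂ refl) = bothPure-kept ge

  special-remainder : ∀ {u} → Special u → remainder ≈ nodeWithEdges u
  special-remainder {u} sp =
    ((λ {x} → near {x}) , edges) , kept⇒⊑remainder (nodeWithEdges u) kept
    where
    -- A kept vertex at distance two or more would make the neighbour of `u` towards it special as
    -- well.
    far : ∀ {e f g} → src e ≡ node u → e ▹ f → f ▹* g → ¬ Kept (tgt g)
    far {e} {f} {g} s d c kg with ge ← special-bothPure {e = e} sp s
      with v , t , sv ← bothPure-chain ge d c (pure-kept-bothPure (pure-▹* (d ◅ c) (proj₁ ge)) kg) =
      special-apart sp sv (subst₂ _~_ s t (src~tgt e))

    near : ∀ {x} → Kept x → x ≡ node u ⊎ node u ~ x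
    near {x} kx with reach-vertex (node u) x
    ... | inj₁ x≡u = inj₁ x≡u
    ... | inj₂ (e , _ , s , ε , refl)     = inj₂ (subst (_~ tgt e) s (src~tgt e))
    ... | inj₂ (e , _ , s , d ◅ c , refl) = contradiction kx (far s d c)

    edges : ∀ {x y} → Edg remainder x y → x ~ y × (x ≡ node u ⊎ y ≡ node u)
    edges {x} {y} (kx , ky , a , _) with reach-edge (node u) (edge x y a)
    ... | _ , s , inj₁ ε       = a , inj₁ s
    ... | _ , s , inj₂ ε       = a , inj₂ s
    ... | _ , s , inj₁ (d ◅ c) = contradiction ky (far s d c)
    ... | _ , s , inj₂ (d ◅ c) = contradiction kx (far s d c)

    kept : ∀ {x} → x ≡ node u ⊎ node u ~ x → Kept x
    kept (inj₂ a)    = bothPure-kept {edge _ _ a} (special-bothPure sp refl)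
    kept (inj₁ refl) = bothPure-kept {reverse (edgeOf (marker u (proj₁ (two-markers u))))}
      (bothPure-reverse (special-bothPure sp refl))

  hybrid-discards : ∀ {u e} → Hybrid u → src e ≡ node u → Discards e
  hybrid-discards {e = e} hy s with q , refl ← at-node e s =
    at-marker (λ a b → Pure a × IsMixed b) (hy q)

  hybrid-remainder : ∀ {u} → Hybrid u → remainder ≈ nodeAlone u
  hybrid-remainder {u} hy = ((λ {x} → only {x}) , no-edges) , kept⇒⊑remainder (nodeAlone u) kept
    where
    only : ∀ {x} → Kept x → x ≡ node u
    only {x} kx with reach-vertex (node u) x
    ... | inj₁ x≡u = x≡u
    ... | inj₂ (e , f , s , c , t) = contradiction (discards-▹* c (hybrid-discards hy s)) (kx f t)

    no-edges : ∀ {x y} → Edg remainder x y → ⊥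
    no-edges (kx , ky , a , _) = ~-irrefl (trans (only kx) (sym (only ky))) a

    kept : ∀ {x} → x ≡ node u → Kept x
    kept refl f t (pf , _) = mixed⇒impure
      (subst (IsMixed ∘ extremity) (reverse-involutive f) (proj₂ (hybrid-discards {e = reverse f} hy t))) pf

  -- A discarded tree-edge into `tgt e` propagates: if it is `e`, along the chain to `tgt g`;
  -- otherwise through `reverse e` to `src e`.
  kept-between : ∀ {e f g} → e ▹ f → f ▹* g → Kept (src e) → Kept (tgt g) → Kept (tgt e)
  kept-between {e} d c ks kt h t dh with src h ≟ⱽ src e
  ... | yes s≡ = kt _ refl (discards-▹* (d ◅ c) (subst Discards (edge-≡ s≡ t) dh))
  ... | no s≢  = ks (reverse e) refl (discards-▹ (t , s≢ ∘ sym) dh)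

  remainder-connected : IsConnected remainder
  remainder-connected {x} {y} kx ky with reach-vertex x y
  ... | inj₁ refl = ε
  ... | inj₂ (_ , _ , refl , c , refl) = walk c kx ky
    where
    walk : ∀ {e f} → e ▹* f → Kept (src e) → Kept (tgt f) → Star (Edg remainder) (src e) (tgt f)
    walk {e} ε ks kt = kept-edge ks kt (src~tgt e) ◅ ε
    walk {e} (d@(refl , _) ◅ c) ks kt with km ← kept-between d c ks kt =
      kept-edge ks km (src~tgt e) ◅ walk c km kt

  edge-cases : ∀ e → FullyMixed e ⊎ BothPure e ⊎ Discards e ⊎ Discards (reverse e)
  edge-cases e with pure? (extremity e) | pure? (extremity (reverse e))
  ... | yes pe | yes pr = inj₂ (inj₁ (pe , pr))
  ... | yes pe | no ¬pr = inj₂ (inj₂ (inj₁ (discards-intro pe ¬pr)))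
  ... | no ¬pe | yes pr = inj₂ (inj₂ (inj₂
    (discards-intro pr (¬pe ∘ subst Pureᴱ (reverse-involutive e)))))
  ... | no ¬pe | no ¬pr = inj₁ (impure⇒mixed ¬pe , impure⇒mixed ¬pr)

  module _ {e : TreeEdge} (mixed : FullyMixed e) where
    remainder-fully-mixed : IsFullyMixed remainder
    remainder-fully-mixed = remainder-connected ,
      (src e , tgt e , kept-edge (fully-mixed-kept (fully-mixed-reverse mixed)) (fully-mixed-kept mixed) (src~tgt e)) ,
      all-mixed
      where
      all-mixed : ∀ f → Edg remainder (src f) (tgt f) → FullyMixed f
      all-mixed f (ks , kt , _) with edge-cases f
      ... | inj₁ m                = m
      ... | inj₂ (inj₁ g)         = contradiction g (fully-mixed⇒¬bothPure mixed)
      ... | inj₂ (inj₂ (inj₁ d))  = contradiction d (kt f refl)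
      ... | inj₂ (inj₂ (inj₂ d))  = contradiction d (ks (reverse f) refl)

    -- Fully-mixed tree-edges keep both ends, and every vertex of `K` is on one because `K` is
    -- connected and has a tree-edge. So the remainder is the greatest such subgraph, hence the
    -- unique maximal one.
    fully-mixed⊑remainder : ∀ {K} → IsFullyMixed K → K ⊑ remainder
    fully-mixed⊑remainder {K} (connected , (a , b , ab) , all-mixed) = kept⇒⊑remainder K vertex
      where
      source : ∀ {x y} → Edg K x y → Kept x
      source h = fully-mixed-kept (fully-mixed-reverse (all-mixed (edge _ _ (Edg⊆~ K h)) h))

      vertex : ∀ {x} → Vtx K x → Kept x
      vertex {x} vx with connected vx (Edg⊆V K ab)
      ... | ε     = source ab
      ... | h ◅ _ = source h

    remainder-fully-mixed-subtree : FullyMixedSubtree remainder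
    remainder-fully-mixed-subtree = remainder-fully-mixed , λ K fm _ → fully-mixed⊑remainder {K} fm

    remainder-unique : ∀ {K} → FullyMixedSubtree K → remainder ≈ K
    remainder-unique {K} (fm , maximal) = maximal remainder remainder-fully-mixed ⊑ , ⊑
      where
      ⊑ : K ⊑ remainder
      ⊑ = fully-mixed⊑remainder {K} fm

  subtree-edge : ∀ {H} → FullyMixedSubtree H → ∃ FullyMixed
  subtree-edge {H} ((_ , (_ , _ , h) , all-mixed) , _) = edge _ _ (Edg⊆~ H h) , all-mixed _ h

  -- Existence of a hybrid node.

  hybrid-exists : ¬ ∃ FullyMixed → ¬ ∃ BothPure → ∃ Hybrid
  hybrid-exists no-mixed no-bothPure =
    Sum.[ search (extremity e₀) (◂-wellFounded _) , search (extremity (reverse e₀)) (◂-wellFounded _) ] start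
    where
    e₀ : TreeEdge
    e₀ = edgeOf (leaf (proj₁ nonempty))

    start : ¬ Pure (extremity e₀) ⊎ ¬ Pure (extremity (reverse e₀))
    start with pure? (extremity e₀)
    ... | no ¬pe = inj₁ ¬pe
    ... | yes pe = inj₂ λ pr → no-bothPure (e₀ , pe , pr)

    -- An impure `a` faces a node `u`. Either another marker of `u` is impure and the search moves
    -- beyond it, or `u` is hybrid.
    search : ∀ a → Acc _◂_ (edgeOf a) → ¬ Pure a → ∃ Hybrid
    search a (acc rec) impure with facing a
    ... | inj₁ (_ , eq) = contradiction (facing-leaf-pure a eq) impure
    ... | inj₂ (u , r , refl) with any? (λ q → ¬? (q Finₚ.≟ r) ×-dec ¬? (pure? (marker u q)))
    ...   | yes (q , q≢r , ¬pq) = search (marker u q) (rec (subst (_▹ edgeOf (marker u q))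
            (sym (edgeOf-opposite (marker u r))) (▹-markers q≢r))) ¬pq
    ...   | no none = u , λ q → pure q , impure⇒mixed {opposite (marker u q)} (opposite-impure q)
      where
      pure : ∀ q → Pure (marker u q)
      pure q with q Finₚ.≟ r
      ... | no q≢r   = decidable-stable (pure? (marker u q)) λ ¬pq → none (q , q≢r , ¬pq)
      -- The marker `r` is opposite to the impure `a`; were it impure too, their tree-edge would be
      -- fully-mixed.
      ... | yes refl = decidable-stable (pure? (marker u q)) λ ¬pq → no-mixed (edgeOf (marker u q) ,
        at-marker (λ a b → IsMixed a × IsMixed b)
          (impure⇒mixed {marker u q} ¬pq , impure⇒mixed {opposite (marker u q)} impure))

      opposite-impure : ∀ q → ¬ Pure (opposite (marker u q))
      opposite-impure q po = no-bothPure (edgeOf (marker u q) ,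
        at-marker (λ a b → Pure a × Pure b) (pure q , po))

  -- Uniqueness of the nodes, and unique tree-edges without special nodes.

  special-unique : ∀ {u v} → Special u → Special v → u ≡ v
  special-unique {u} {v} su sv
    -- Both nodes describe the same remainder, so `v` is `u` or a neighbour of it.
    with proj₁ (proj₁ (special-remainder su)) (proj₁ (proj₂ (special-remainder sv)) (inj₁ refl))
  ... | inj₁ refl = refl
  ... | inj₂ u~v  = contradiction u~v (special-apart su sv)

  hybrid-unique : ∀ {u v} → Hybrid u → Hybrid v → u ≡ v
  hybrid-unique {u} {v} hu hv =
    sym (node-injective (proj₁ (proj₁ (hybrid-remainder hu)) (proj₁ (proj₂ (hybrid-remainder hv)) refl)))

  special-incident : ∀ {u e} → Special u → BothPure e → ∃ λ q → edgeOf (marker u q) ≈ᴱ e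
  special-incident {u} {e} sp ge
    with proj₂ (proj₂ (proj₁ (special-remainder sp))
      (kept-edge (bothPure-kept (bothPure-reverse ge)) (bothPure-kept ge) (src~tgt e)))
  ... | inj₁ s with q , refl ← at-node e s = q , inj₁ (refl , refl)
  ... | inj₂ t with q , re≡ ← at-node (reverse e) t = q , subst (_≈ᴱ e) re≡ (inj₂ (refl , refl))

  edgeOf-injective : ∀ {a b} → edgeOf a ≡ edgeOf b → a ≡ b
  edgeOf-injective {a} {b} eq =
    trans (sym (extremity-edgeOf a)) (trans (cong extremity eq) (extremity-edgeOf b))

  not-both-≈ᴱ : ∀ {u q r e} → q ≢ r → e ≈ᴱ edgeOf (marker u q) → ¬ e ≈ᴱ edgeOf (marker u r)
  not-both-≈ᴱ q≢r (inj₁ (_ , t)) (inj₁ (_ , t′)) =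
    q≢r (marker-injective (edgeOf-injective (edge-≡ refl (trans (sym t) t′))))
  not-both-≈ᴱ q≢r (inj₂ (s , _)) (inj₂ (s′ , _)) =
    q≢r (marker-injective (edgeOf-injective (edge-≡ refl (trans (sym s) s′))))
  not-both-≈ᴱ {e = e} q≢r (inj₁ (s , _)) (inj₂ (_ , t)) = ~-irrefl (trans s (sym t)) (src~tgt e)
  not-both-≈ᴱ {e = e} q≢r (inj₂ (_ , t)) (inj₁ (s , _)) = ~-irrefl (trans s (sym t)) (src~tgt e)

  PP-resp-≈ᴱ : ∀ {e f} → e ≈ᴱ f → PP e → PP f
  PP-resp-≈ᴱ {e} {f} e≈f (pf , pf′) with ≈ᴱ⇒≡ {e} {f} e≈f
  ... | inj₁ refl = pf , pf′
  ... | inj₂ refl = subst (IsPerfect ∘ extremity) (reverse-involutive f) pf′ , pf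

  -- A special clique has several PP tree-edges, and a special star would have `e` among its
  -- tree-edges, which are all PE. This and the PE version separate cases 5 and 6 from cases 1 and
  -- 2.
  unique-PP⇒¬special : ∀ {e} → IsUnique _≈ᴱ_ PP e → ¬ ∃ Special
  unique-PP⇒¬special {e} (_ , unique) (u , inj₁ cl) with q , r , q≢r ← two-markers u =
    not-both-≈ᴱ {e = e} q≢r (unique (clique⇒PP cl q)) (unique (clique⇒PP cl r))
  unique-PP⇒¬special {e} (pp , _) (u , inj₂ st)
    with q , q≈e ← special-incident {e = e} (inj₂ st) (PP⇒bothPure pp) =
    PP⇒¬PE (PP-resp-≈ᴱ {e} {edgeOf (marker u q)} (≈ᴱ-sym {edgeOf (marker u q)} {e} q≈e) pp) (star⇒PE st q)
    where
    ≈ᴱ-sym : ∀ {e f} → e ≈ᴱ f → f ≈ᴱ e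
    ≈ᴱ-sym (inj₁ (s , t)) = inj₁ (sym s , sym t)
    ≈ᴱ-sym (inj₂ (s , t)) = inj₂ (sym t , sym s)

  unique-PE⇒¬special : ∀ {e} → IsUnique _≈ᴱ_ PE e → ¬ ∃ Special
  unique-PE⇒¬special {e} (_ , unique) (u , inj₂ st) with q , r , q≢r ← two-markers u =
    not-both-≈ᴱ {e = e} q≢r
      (unique {edgeOf (marker u q)} (star⇒PE st q)) (unique {edgeOf (marker u r)} (star⇒PE st r))
  unique-PE⇒¬special {e} (pe , _) (u , inj₁ cl)
    with q , q≈e ← special-incident {e = e} (inj₁ cl) (PE⇒bothPure {e} pe) =
    PP⇒¬PE (PP-resp-≈ᴱ {edgeOf (marker u q)} {e} q≈e (clique⇒PP cl q)) pe

  unspecial-remainder : ∀ {e} → BothPure e → ¬ ∃ Special → remainder ≈ edgeAlone e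
  unspecial-remainder {e} ge no-special with special-or-single {e} ge
  ... | inj₁ special = contradiction special no-special
  ... | inj₂ single  = single-remainder ge λ {f} → single {f}

  -- The remainder in each case, and existence of a case.

  condition-remainder : ∀ {i H} → Condition i H → remainder ≈ H
  condition-remainder (clique-node (cl , _))         = special-remainder (inj₁ cl)
  condition-remainder (star-node (st , _))           = special-remainder (inj₂ st)
  condition-remainder (prime-hybrid (hy , _) _)      = hybrid-remainder hy
  condition-remainder (degenerate-hybrid (hy , _) _) = hybrid-remainder hy
  condition-remainder (PP-edge {e} un@(pp , _)) = unspecial-remainder {e} (PP⇒bothPure pp) (unique-PP⇒¬special {e} un)
  condition-remainder (PE-edge {e} un@(pe , _)) = unspecial-remainder {e} (PE⇒bothPure {e} pe) (unique-PE⇒¬special {e} un)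
  condition-remainder (fully-mixed {H} (fm , _)) = remainder-unique (proj₂ (subtree-edge {H} fm)) {H} fm

  condition-exists : ∃₂ Condition
  condition-exists with any-edge? fully-mixed? | any-edge? bothPure?
    where
    fully-mixed? : ∀ e → Dec (FullyMixed e)
    fully-mixed? e = mixed? (extremity e) ×-dec mixed? (extremity (reverse e))
      where
      mixed? : ∀ a → Dec (IsMixed a)
      mixed? a = map′ (impure⇒mixed {a}) (mixed⇒impure {a}) (¬? (pure? a))
  ... | yes (e , m) | _ = _ , remainder ,
    fully-mixed (remainder-fully-mixed-subtree m , λ {K} fm → remainder-unique m {K} fm)
  ... | no _ | yes (e , ge) with special-or-single {e} ge
  ...   | inj₁ (u , inj₁ cl) = _ , _ , clique-node (cl , λ cl′ → special-unique (inj₁ cl) (inj₁ cl′))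
  ...   | inj₁ (u , inj₂ st) = _ , _ , star-node (st , λ st′ → special-unique (inj₂ st) (inj₂ st′))
  ...   | inj₂ single with bothPure⇒PP⊎PE {e} ge
  ...     | inj₁ pp = _ , _ , PP-edge {e} (pp , λ {f} pp′ → single {f} (PP⇒bothPure pp′))
  ...     | inj₂ pe = _ , _ , PE-edge {e} (pe , λ {f} pe′ → single {f} (PE⇒bothPure {f} pe′))
  condition-exists | no no-mixed | no no-bothPure with u , hy ← hybrid-exists no-mixed no-bothPure
    with label-kind u
  ... | inj₁ prime      = _ , _ , prime-hybrid (hy , hybrid-unique hy) prime
  ... | inj₂ degenerate = _ , _ , degenerate-hybrid (hy , hybrid-unique hy) degenerate

  -- Mutual exclusion of the cases.

  data Kind : Set where
    mixed special single hybrid : Kind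

  -- Grouping the conditions into four kinds reduces exclusion to the pairs of kinds and the pairs
  -- inside one kind.
  kind : Fin 7 → Kind
  kind 0F = special
  kind 1F = special
  kind 2F = hybrid
  kind 3F = hybrid
  kind 4F = single
  kind 5F = single
  kind 6F = mixed

  -- Special nodes also have tree-edges pure at both extremities, so the kind `single` records that
  -- there is no special node.
  Witness : Kind → Set
  Witness mixed   = ∃ FullyMixed
  Witness special = ∃ Special
  Witness single  = ∃ BothPure × ¬ ∃ Special
  Witness hybrid  = ∃ Hybrid

  condition-witness : ∀ {i H} → Condition i H → Witness (kind i)
  condition-witness (clique-node (cl , _))         = _ , inj₁ cl
  condition-witness (star-node (st , _))           = _ , inj₂ st
  condition-witness (prime-hybrid (hy , _) _)      = _ , hy
  condition-witness (degenerate-hybrid (hy , _) _) = _ , hy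
  condition-witness (PP-edge {e} un@(pp , _)) = (e , PP⇒bothPure pp) , unique-PP⇒¬special {e} un
  condition-witness (PE-edge {e} un@(pe , _)) = (e , PE⇒bothPure {e} pe) , unique-PE⇒¬special {e} un
  condition-witness (fully-mixed {H} (fm , _)) = subtree-edge {H} fm

  some-bothPure : ∃ Special → ∃ BothPure
  some-bothPure (u , sp) with q , _ ← two-markers u = edgeOf (marker u q) , special-bothPure sp refl

  -- With a hybrid node the remainder is a single vertex, while the tree-edges witnessing the other
  -- kinds keep both ends.
  hybrid⇒no-kept-edge : ∀ {x y} → ∃ Hybrid → Kept x → Kept y → ¬ x ~ y
  hybrid⇒no-kept-edge (_ , hy) kx ky a = proj₂ (proj₁ (hybrid-remainder hy)) (kept-edge kx ky a)

  mixed-bothPure : ∃ FullyMixed → ¬ ∃ BothPure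
  mixed-bothPure (_ , m) (_ , g) = fully-mixed⇒¬bothPure m g

  mixed-hybrid : ∃ FullyMixed → ¬ ∃ Hybrid
  mixed-hybrid (e , m) hy =
    hybrid⇒no-kept-edge hy (fully-mixed-kept (fully-mixed-reverse m)) (fully-mixed-kept m) (src~tgt e)

  bothPure-hybrid : ∃ BothPure → ¬ ∃ Hybrid
  bothPure-hybrid (e , g) hy = hybrid⇒no-kept-edge hy (bothPure-kept (bothPure-reverse g)) (bothPure-kept g) (src~tgt e)

  witness-unique : ∀ k l → Witness k → Witness l → k ≡ l
  witness-unique mixed   mixed   _ _ = refl
  witness-unique special special _ _ = refl
  witness-unique single  single  _ _ = refl
  witness-unique hybrid  hybrid  _ _ = refl
  witness-unique mixed   special m s = ⊥-elim (mixed-bothPure m (some-bothPure s))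
  witness-unique special mixed   s m = ⊥-elim (mixed-bothPure m (some-bothPure s))
  witness-unique mixed   single  m (g , _) = ⊥-elim (mixed-bothPure m g)
  witness-unique single  mixed   (g , _) m = ⊥-elim (mixed-bothPure m g)
  witness-unique mixed   hybrid  m h = ⊥-elim (mixed-hybrid m h)
  witness-unique hybrid  mixed   h m = ⊥-elim (mixed-hybrid m h)
  witness-unique special single  s (_ , ¬s) = contradiction s ¬s
  witness-unique single  special (_ , ¬s) s = contradiction s ¬s
  witness-unique special hybrid  s h = ⊥-elim (bothPure-hybrid (some-bothPure s) h)
  witness-unique hybrid  special h s = ⊥-elim (bothPure-hybrid (some-bothPure s) h)
  witness-unique single  hybrid  (g , _) h = ⊥-elim (bothPure-hybrid g h)
  witness-unique hybrid  single  h (g , _) = ⊥-elim (bothPure-hybrid g h)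

  clique-star-exclusive : ∃ PerfectClique → ¬ ∃ PerfectCentreStar
  clique-star-exclusive (u , cl) (v , st) with refl ← special-unique (inj₁ cl) (inj₂ st)
    with q , _ ← two-markers u =
    PP⇒¬PE (clique⇒PP cl q) (star⇒PE st q)

  prime-degenerate-exclusive : ∀ {u v} → Hybrid u → Hybrid v → IsPrime (label u) → ¬ IsDegenerate (label v)
  prime-degenerate-exclusive hu hv (_ , _ , ¬degenerate) with refl ← hybrid-unique hu hv = ¬degenerate

  PP-PE-exclusive : ∀ {e f} → PP e → PE f → ¬ ∃ Special → ⊥
  PP-PE-exclusive {e} {f} pp pe no-special with special-or-single {e} (PP⇒bothPure pp)
  ... | inj₁ sp     = no-special sp
  ... | inj₂ alone  = PP⇒¬PE (PP-resp-≈ᴱ {e} {f} (alone {f} (PE⇒bothPure {f} pe)) pp) pe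

  condition-unique-within : ∀ {i j H K} → Condition i H → Condition j K → kind i ≡ kind j → i ≡ j
  condition-unique-within (clique-node _) (clique-node _) refl = refl
  condition-unique-within (star-node _) (star-node _) refl = refl
  condition-unique-within (prime-hybrid _ _) (prime-hybrid _ _) refl = refl
  condition-unique-within (degenerate-hybrid _ _) (degenerate-hybrid _ _) refl = refl
  condition-unique-within (PP-edge _) (PP-edge _) refl = refl
  condition-unique-within (PE-edge _) (PE-edge _) refl = refl
  condition-unique-within (fully-mixed _) (fully-mixed _) refl = refl
  condition-unique-within (clique-node (cl , _)) (star-node (st , _)) refl =
    ⊥-elim (clique-star-exclusive (_ , cl) (_ , st))
  condition-unique-within (star-node (st , _)) (clique-node (cl , _)) refl =
    ⊥-elim (clique-star-exclusive (_ , cl) (_ , st))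
  condition-unique-within (prime-hybrid (h , _) pr) (degenerate-hybrid (h′ , _) de) refl =
    ⊥-elim (prime-degenerate-exclusive h h′ pr de)
  condition-unique-within (degenerate-hybrid (h , _) de) (prime-hybrid (h′ , _) pr) refl =
    ⊥-elim (prime-degenerate-exclusive h′ h pr de)
  condition-unique-within (PP-edge {e} un@(pp , _)) (PE-edge {f} (pe , _)) refl =
    ⊥-elim (PP-PE-exclusive {e} {f} pp pe (unique-PP⇒¬special {e} un))
  condition-unique-within (PE-edge {f} (pe , _)) (PP-edge {e} un@(pp , _)) refl =
    ⊥-elim (PP-PE-exclusive {e} {f} pp pe (unique-PP⇒¬special {e} un))

  condition-unique : ∀ {i j H K} → Condition i H → Condition j K → i ≡ j
  condition-unique {i} {j} c d = condition-unique-within c d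
    (witness-unique (kind i) (kind j) (condition-witness c) (condition-witness d))

theorem4p14 : ∀ {n p} (G : Graph (Fin n)) → 2 ≤ n → Connected G →
    (𝒯 : GLT n p) → IsSplitTreeOf 𝒯 G →
    (S : Subset n) → Nonempty S →
    let open Marked G 𝒯 S
        open Subgraphs (GLT.tree 𝒯)
    in ∃! _≡_ (λ i → ∃ (Condition i)) × (∀ {i H} → Condition i H → remainder ≈ H)
theorem4p14 G _ _ 𝒯 split S nonempty =
  (i , (H , c) , λ (_ , d) → condition-unique c d) , condition-remainder
  where
  open Classification G 𝒯 split S nonempty
  i = proj₁ condition-exists
  H = proj₁ (proj₂ condition-exists)
  c = proj₂ (proj₂ condition-exists)
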